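{- There is a constant $\varepsilon>0$ such that every (possibly adaptive, two-sided error) $\varepsilon$-tester for the problem Truestring equivalence$(n)$ requires $\Omega(n^{1/5})$ queries.
   Context: For a string $w\in\{0,1,\diamond\}^*$, its truestring $T(w)$ is the subsequence obtained by deleting all $\diamond$ characters. Two strings $w,v$ are truestring equivalent if $T(w)=T(v)$. Truestring equivalence$(n)$: given two strings of length $n$ over $\{0,1,\diamond\}$, decide whether they are truestring equivalent. The distance between two pairs of strings $(w,v)$ and $(\tilde w,\tilde v)$, all of length $n$, is the sum of the Hamming distances of $w,\tilde w$ and of $v,\tilde v$. A pair is $\varepsilon$-far from truestring equivalence if its distance from every truestring equivalent pair exceeds $\varepsilon n$. A randomized algorithm is an $\varepsilon$-tester if it accepts every truestring equivalent pair with probability at least $2/3$ and rejects every pair that is $\varepsilon$-far from truestring equivalence with probability at least $2/3$. The algorithm knows $n$ and accesses the two strings only by querying single characters; the number of queries is measured in the worst case. -}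

module Defs where

open import Data.Bool using (Bool; true; false; not; if_then_else_)
open import Data.Fin using (Fin)
open import Data.Integer using (+_)
open import Data.List using (List; catMaybes)
open import Data.Maybe using (Maybe)
open import Data.Maybe.Properties using (≡-dec)
import Data.Bool.Properties as Bool
open import Data.Nat using (ℕ; suc; _+_; _⊔_) renaming (_≤_ to _≤ℕ_)
import Data.Nat.Properties as ℕ
open import Data.Product using (_×_; _,_; ∃-syntax; uncurry)
open import Data.Rational as ℚ using (ℚ; 0ℚ; 1ℚ; ½)
import Data.Rational.Properties as ℚ
open import Data.Rational.Solver using (module +-*-Solver)
open import Data.Vec using (Vec; lookup; toList; zip; count)
import Data.Vec.Functional as F
open import Relation.Binary.Definitions using (DecidableEquality)
open import Relation.Binary.PropositionalEquality using (_≡_; refl; sym; trans; cong)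
open import Relation.Nullary.Decidable using (¬?)

-- Probabilities are real numbers. A real is a Cauchy sequence of rationals;
-- equality of reals is _≈_, not _≡_.

Cauchy : (ℕ → ℚ) → Set
Cauchy x = ∀ (δ : ℚ) → 0ℚ ℚ.< δ →
  ∃[ N ] (∀ i j → N ≤ℕ i → N ≤ℕ j → ℚ.∣ x i ℚ.- x j ∣ ℚ.≤ δ)

record ℝ : Set where
  constructor mkℝ
  field
    seq    : ℕ → ℚ
    cauchy : Cauchy seq

open ℝ public

infix 4 _≤ᵣ_ _≈_
infixl 6 _+ᵣ_

_≤ᵣ_ : ℝ → ℝ → Set
x ≤ᵣ y = ∀ (δ : ℚ) → 0ℚ ℚ.< δ →
  ∃[ N ] (∀ i → N ≤ℕ i → seq x i ℚ.≤ seq y i ℚ.+ δ)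

_≈_ : ℝ → ℝ → Set
x ≈ y = x ≤ᵣ y × y ≤ᵣ x

fromℚ : ℚ → ℝ
fromℚ p = mkℝ (λ _ → p) λ δ 0<δ → 0 , λ _ _ _ _ →
  ℚ.≤-trans (ℚ.≤-reflexive (cong ℚ.∣_∣ (ℚ.+-inverseʳ p))) (ℚ.<⇒≤ 0<δ)

private
  0<½*δ : ∀ δ → 0ℚ ℚ.< δ → 0ℚ ℚ.< ½ ℚ.* δ
  0<½*δ δ 0<δ = ℚ.positive⁻¹ (½ ℚ.* δ) {{ℚ.pos*pos⇒pos ½ δ {{ℚ.positive 0<δ}}}}

  ½*δ+½*δ≡δ : ∀ δ → ½ ℚ.* δ ℚ.+ ½ ℚ.* δ ≡ δ
  ½*δ+½*δ≡δ δ = trans (sym (ℚ.*-distribʳ-+ δ ½ ½)) (ℚ.*-identityˡ δ)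

  rearrange : ∀ a b c d →
    (a ℚ.+ b) ℚ.- (c ℚ.+ d) ≡ (a ℚ.- c) ℚ.+ (b ℚ.- d)
  rearrange = solve 4 (λ a b c d →
    (a :+ b) :- (c :+ d) := (a :- c) :+ (b :- d)) refl
    where open +-*-Solver

_+ᵣ_ : ℝ → ℝ → ℝ
mkℝ x x-cauchy +ᵣ mkℝ y y-cauchy = mkℝ (λ i → x i ℚ.+ y i) sum-cauchy
  where
  sum-cauchy : Cauchy (λ i → x i ℚ.+ y i)
  sum-cauchy δ 0<δ
    with x-cauchy (½ ℚ.* δ) (0<½*δ δ 0<δ) | y-cauchy (½ ℚ.* δ) (0<½*δ δ 0<δ)
  ... | M , hx | N , hy = M ⊔ N , λ i j i≥ j≥ → begin
    ℚ.∣ (x i ℚ.+ y i) ℚ.- (x j ℚ.+ y j) ∣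
      ≡⟨ cong ℚ.∣_∣ (rearrange (x i) (y i) (x j) (y j)) ⟩
    ℚ.∣ (x i ℚ.- x j) ℚ.+ (y i ℚ.- y j) ∣
      ≤⟨ ℚ.∣p+q∣≤∣p∣+∣q∣ (x i ℚ.- x j) (y i ℚ.- y j) ⟩
    ℚ.∣ x i ℚ.- x j ∣ ℚ.+ ℚ.∣ y i ℚ.- y j ∣
      ≤⟨ ℚ.+-mono-≤
           (hx i j (ℕ.m⊔n≤o⇒m≤o M N i≥) (ℕ.m⊔n≤o⇒m≤o M N j≥))
           (hy i j (ℕ.m⊔n≤o⇒n≤o M N i≥) (ℕ.m⊔n≤o⇒n≤o M N j≥)) ⟩
    ½ ℚ.* δ ℚ.+ ½ ℚ.* δ
      ≡⟨ ½*δ+½*δ≡δ δ ⟩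
    δ ∎
    where open ℚ.≤-Reasoning

∑ : ∀ {m} → (Fin m → ℝ) → ℝ
∑ = F.foldr _+ᵣ_ (fromℚ 0ℚ)

-- The alphabet {0,1,⋄}: `just false` is 0, `just true` is 1, `nothing` is ⋄.

Symbol : Set
Symbol = Maybe Bool

_≟_ : DecidableEquality Symbol
_≟_ = ≡-dec Bool._≟_

truestring : ∀ {n} → Vec Symbol n → List Bool
truestring w = catMaybes (toList w)

TruestringEquivalent : ∀ {n} → Vec Symbol n → Vec Symbol n → Set
TruestringEquivalent w v = truestring w ≡ truestring v

hamming : ∀ {n} → Vec Symbol n → Vec Symbol n → ℕ
hamming w w′ = count (λ p → ¬? (uncurry _≟_ p)) (zip w w′)

pairDistance : ∀ {n} (w v w′ v′ : Vec Symbol n) → ℕ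
pairDistance w v w′ v′ = hamming w w′ + hamming v v′

fromℕ : ℕ → ℚ
fromℕ k = + k ℚ./ 1

Far : ∀ {n} → ℚ → Vec Symbol n → Vec Symbol n → Set
Far {n} ε w v = ∀ (w′ v′ : Vec Symbol n) → TruestringEquivalent w′ v′ →
  ε ℚ.* fromℕ n ℚ.< fromℕ (pairDistance w v w′ v′)

-- Deterministic adaptive algorithms: the next query (or the output, `true`
-- meaning accept) may depend on the answers to all previous queries.

data DecisionTree (n : ℕ) : Set where
  output : Bool → DecisionTree n
  query₁ : Fin n → (Symbol → DecisionTree n) → DecisionTree n
  query₂ : Fin n → (Symbol → DecisionTree n) → DecisionTree n

run : ∀ {n} → DecisionTree n → Vec Symbol n → Vec Symbol n → Bool
run (output b)   w v = b
run (query₁ i t) w v = run (t (lookup w i)) w v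
run (query₂ i t) w v = run (t (lookup v i)) w v

queries : ∀ {n} → DecisionTree n → Vec Symbol n → Vec Symbol n → ℕ
queries (output b)   w v = 0
queries (query₁ i t) w v = suc (queries (t (lookup w i)) w v)
queries (query₂ i t) w v = suc (queries (t (lookup v i)) w v)

-- A randomized algorithm is a probability distribution on decision trees.
-- Finite support loses no generality: for given n and q there are, up to
-- extensional equality, only finitely many trees of depth at most q.

record RandomizedAlgorithm (n : ℕ) : Set where
  field
    support    : ℕ
    tree       : Fin support → DecisionTree n
    weight     : Fin support → ℝ
    weight≥0   : ∀ s → fromℚ 0ℚ ≤ᵣ weight s
    ∑-weight≈1 : ∑ weight ≈ fromℚ 1ℚ

open RandomizedAlgorithm public

probability : ∀ {n} (A : RandomizedAlgorithm n) → (Fin (support A) → Bool) → ℝ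
probability A E = ∑ (λ s → if E s then weight A s else fromℚ 0ℚ)

Pr[_accepts_,_] : ∀ {n} → RandomizedAlgorithm n → Vec Symbol n → Vec Symbol n → ℝ
Pr[ A accepts w , v ] = probability A (λ s → run (tree A s) w v)

Pr[_rejects_,_] : ∀ {n} → RandomizedAlgorithm n → Vec Symbol n → Vec Symbol n → ℝ
Pr[ A rejects w , v ] = probability A (λ s → not (run (tree A s) w v))

MakesAtMost : ∀ {n} → ℕ → RandomizedAlgorithm n → Set
MakesAtMost q A = ∀ s w v → queries (tree A s) w v ≤ℕ q

⅔ : ℝ
⅔ = fromℚ (+ 2 ℚ./ 3)

IsTester : ∀ {n} → ℚ → RandomizedAlgorithm n → Set
IsTester {n} ε A =
    (∀ (w v : Vec Symbol n) → TruestringEquivalent w v → ⅔ ≤ᵣ Pr[ A accepts w , v ])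
  × (∀ (w v : Vec Symbol n) → Far ε w v → ⅔ ≤ᵣ Pr[ A rejects w , v ])

{-# OPTIONS --safe #-}
module Submission where

open import Defs
open import Data.Nat using (ℕ; _*_; _^_; _≤_; _<_)
open import Data.Product using (Σ-syntax; _×_)
open import Data.Rational using (ℚ; 0ℚ) renaming (_<_ to _<ℚ_)

open import Algebra.Bundles using (module CommutativeRing)
import Algebra.Properties.Semiring.Sum as Sum-of
open import Data.Bool using (Bool; true; false; not; if_then_else_; _∧_; _∨_)
import Data.Bool.Properties as Bool
open import Data.Empty using (⊥)
open import Data.Fin as Fin using (Fin; zero; suc; toℕ; fromℕ<; splitAt; quotient; remainder; combine)
import Data.Fin.Properties as Fin
import Data.Integer as ℤ
import Data.Integer.Properties as ℤ
open import Data.List as List using (List; []; _∷_; applyUpTo; catMaybes; length)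
open import Data.List.Membership.Propositional using (_∈_)
import Data.List.Properties as List
open import Data.List.Relation.Unary.All as All using (All; []; _∷_)
import Data.List.Relation.Unary.All.Properties as All
open import Data.List.Relation.Unary.Any as Any using (here; there; any?)
open import Data.Maybe using (just; nothing)
open import Data.Nat using (zero; suc; _+_; _∸_; _⊔_; _/_; _%_; z≤n; s≤s)
import Data.Nat.Coprimality as Coprime
import Data.Nat.DivMod as ℕ
open import Data.Nat.ListAction using () renaming (sum to sumᴸ)
import Data.Nat.Properties as ℕ
open import Data.Nat.Solver using () renaming (module +-*-Solver to ℕ-Solver)
open import Data.Product using (_,_; ∃-syntax; proj₁; proj₂)
open import Data.Rational as ℚ using (1ℚ; ½)
import Data.Rational.Properties as ℚ
open import Data.Rational.Solver using (module +-*-Solver)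
open import Data.Sum as Sum using (_⊎_; inj₁; inj₂; [_,_]′)
import Data.Sum.Properties as Sum
open import Data.Unit using (⊤; tt)
open import Data.Vec as Vec
  using (Vec; []; _∷_; head; tail; lookup; toList; replicate; tabulate; concat; _[_]≔_)
import Data.Vec.Properties as Vec
open import Function using (_∘_)
open import Relation.Binary.PropositionalEquality
  using (_≡_; _≢_; refl; sym; trans; cong; cong₂; subst; subst₂; module ≡-Reasoning)
open import Relation.Nullary.Decidable using (Dec; yes; no; does; dec-true; ¬?; _×-dec_)
open import Relation.Nullary.Negation using (¬_; contradiction)

module ∑ℕ = Sum-of ℕ.+-*-semiring
module ∑ℚ = Sum-of (CommutativeRing.semiring ℚ.+-*-commutativeRing)
open ∑ℚ using (sum)

-- Let T be a random bit string of length S + D. In a string of length m S + D + m S the middle D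
-- positions carry T[s .. s+D), while the first s letters and the last S − s letters of T hide in
-- one block, number r, among m blocks of S positions on the left and on the right; the other
-- blocks are blank. The pair with shifts 0 and s is truestring equivalent. For random r < m and
-- s < S, a query outside the middle finds block r with probability 1 / m, and middle queries i to
-- the first and j to the second string read the same letter of T only if i = s + j, which has
-- probability at most 1 / S. Unless q / m + q² / S is large, q queries therefore see what they see
-- in a pair of independent random strings with blank sides, and such a pair is far from truestring
-- equivalence because random strings are far apart in insertion-deletion distance. With m about q
-- and S about q² all of this fits into length n as soon as n is at least a multiple of q³, so the
-- argument even yields Ω(n^{1/3}).

-- Averages over bit strings and decision trees of random bits

𝟙 : Bool → ℚ
𝟙 b = if b then 1ℚ else 0ℚ

0≤𝟙 : ∀ b → 0ℚ ℚ.≤ 𝟙 b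
0≤𝟙 true = ℚ.≤ᵇ⇒≤ _
0≤𝟙 false = ℚ.≤-refl

𝟙≤1 : ∀ b → 𝟙 b ℚ.≤ 1ℚ
𝟙≤1 true = ℚ.≤-refl
𝟙≤1 false = ℚ.≤ᵇ⇒≤ _

sum-mono : ∀ {k} {f g : Fin k → ℚ} → (∀ i → f i ℚ.≤ g i) → sum f ℚ.≤ sum g
sum-mono {zero} f≤g = ℚ.≤-refl
sum-mono {suc k} f≤g = ℚ.+-mono-≤ (f≤g zero) (sum-mono (f≤g ∘ suc))

avg : ℚ → ℚ → ℚ
avg a b = ½ ℚ.* (a ℚ.+ b)

avg-mono : ∀ {a b c d} → a ℚ.≤ b → c ℚ.≤ d → avg a c ℚ.≤ avg b d
avg-mono a≤b c≤d = ℚ.*-monoˡ-≤-nonNeg ½ (ℚ.+-mono-≤ a≤b c≤d)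

avg-idem : ∀ a → avg a a ≡ a
avg-idem = solve 1 (λ a → con ½ :* (a :+ a) := a) refl
  where open +-*-Solver

avg-+ : ∀ a b c d → avg (a ℚ.+ b) (c ℚ.+ d) ≡ avg a c ℚ.+ avg b d
avg-+ = solve 4 (λ a b c d → con ½ :* ((a :+ b) :+ (c :+ d))
                          := con ½ :* (a :+ c) :+ con ½ :* (b :+ d)) refl
  where open +-*-Solver

avg-* : ∀ a b c → avg (a ℚ.* b) (a ℚ.* c) ≡ a ℚ.* avg b c
avg-* = solve 3 (λ a b c → con ½ :* (a :* b :+ a :* c) := a :* (con ½ :* (b :+ c))) refl
  where open +-*-Solver

avg-avg : ∀ a b c d → avg (avg a b) (avg c d) ≡ avg (avg a c) (avg b d)
avg-avg = solve 4 (λ a b c d → con ½ :* (con ½ :* (a :+ b) :+ con ½ :* (c :+ d))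
                            := con ½ :* (con ½ :* (a :+ c) :+ con ½ :* (b :+ d))) refl
  where open +-*-Solver

𝔼 : ∀ {N} → (Vec Bool N → ℚ) → ℚ
𝔼 {zero} f = f []
𝔼 {suc N} f = avg (𝔼 (f ∘ (false ∷_))) (𝔼 (f ∘ (true ∷_)))

𝔼-mono : ∀ {N} {f g : Vec Bool N → ℚ} → (∀ z → f z ℚ.≤ g z) → 𝔼 f ℚ.≤ 𝔼 g
𝔼-mono {zero} f≤g = f≤g []
𝔼-mono {suc N} f≤g = avg-mono (𝔼-mono (f≤g ∘ (false ∷_))) (𝔼-mono (f≤g ∘ (true ∷_)))

𝔼-cong : ∀ {N} {f g : Vec Bool N → ℚ} → (∀ z → f z ≡ g z) → 𝔼 f ≡ 𝔼 g
𝔼-cong {zero} f≡g = f≡g []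
𝔼-cong {suc N} f≡g = cong₂ avg (𝔼-cong (f≡g ∘ (false ∷_))) (𝔼-cong (f≡g ∘ (true ∷_)))

𝔼-const : ∀ {N} a → 𝔼 {N} (λ _ → a) ≡ a
𝔼-const {zero} a = refl
𝔼-const {suc N} a = trans (cong₂ avg (𝔼-const {N} a) (𝔼-const {N} a)) (avg-idem a)

𝔼-+ : ∀ {N} (f g : Vec Bool N → ℚ) → 𝔼 (λ z → f z ℚ.+ g z) ≡ 𝔼 f ℚ.+ 𝔼 g
𝔼-+ {zero} f g = refl
𝔼-+ {suc N} f g = trans
  (cong₂ avg (𝔼-+ (f ∘ (false ∷_)) (g ∘ (false ∷_))) (𝔼-+ (f ∘ (true ∷_)) (g ∘ (true ∷_))))
  (avg-+ (𝔼 (f ∘ (false ∷_))) (𝔼 (g ∘ (false ∷_))) (𝔼 (f ∘ (true ∷_))) (𝔼 (g ∘ (true ∷_))))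

𝔼-* : ∀ {N} a (f : Vec Bool N → ℚ) → 𝔼 (λ z → a ℚ.* f z) ≡ a ℚ.* 𝔼 f
𝔼-* {zero} a f = refl
𝔼-* {suc N} a f = trans
  (cong₂ avg (𝔼-* a (f ∘ (false ∷_))) (𝔼-* a (f ∘ (true ∷_))))
  (avg-* a (𝔼 (f ∘ (false ∷_))) (𝔼 (f ∘ (true ∷_))))

𝔼-sum : ∀ {N k} (g : Fin k → Vec Bool N → ℚ) → 𝔼 (λ z → sum (λ i → g i z)) ≡ sum (λ i → 𝔼 (g i))
𝔼-sum {N} {zero} g = 𝔼-const {N} 0ℚ
𝔼-sum {N} {suc k} g =
  trans (𝔼-+ (g zero) (λ z → sum (λ i → g (suc i) z))) (cong (𝔼 (g zero) ℚ.+_) (𝔼-sum (g ∘ suc)))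

𝔼-++ : ∀ M {N} (f : Vec Bool (M + N) → ℚ) → 𝔼 f ≡ 𝔼 {M} (λ x → 𝔼 (λ y → f (x Vec.++ y)))
𝔼-++ zero f = refl
𝔼-++ (suc M) f = cong₂ avg (𝔼-++ M (f ∘ (false ∷_))) (𝔼-++ M (f ∘ (true ∷_)))

-- Coordinate `c` is a fair coin independent of the others, so it may be tossed before them. This
-- peels the answer to one query off an average.
𝔼-resample : ∀ {N} (c : Fin N) (f : Vec Bool N → ℚ) →
  𝔼 f ≡ avg (𝔼 (λ z → f (z [ c ]≔ false))) (𝔼 (λ z → f (z [ c ]≔ true)))
𝔼-resample {suc N} zero f = sym 
  (cong₂ avg (avg-idem (𝔼 (f ∘ (false ∷_)))) (avg-idem (𝔼 (f ∘ (true ∷_)))))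
𝔼-resample {suc N} (suc c) f = trans
  (cong₂ avg (𝔼-resample c (f ∘ (false ∷_))) (𝔼-resample c (f ∘ (true ∷_))))
  (avg-avg (𝔼 (λ z → f (false ∷ (z [ c ]≔ false)))) (𝔼 (λ z → f (false ∷ (z [ c ]≔ true))))
           (𝔼 (λ z → f (true ∷ (z [ c ]≔ false)))) (𝔼 (λ z → f (true ∷ (z [ c ]≔ true)))))

-- Queries are abstract labels rather than coordinates, so that one tree can be run both on letters
-- shared between two strings and on independent ones.
data BitTree (L : Set) : Set where
  leaf : Bool → BitTree L
  ask  : L → (Bool → BitTree L) → BitTree L

module _ {L : Set} where

  eval : BitTree L → (L → Bool) → Bool
  eval (leaf b)  o = b
  eval (ask l t) o = eval (t (o l)) o

  eval-cong : ∀ t {o o′ : L → Bool} → (∀ l → o l ≡ o′ l) → eval t o ≡ eval t o′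
  eval-cong (leaf b) o≗o′ = refl
  eval-cong (ask l t) {o} {o′} o≗o′ rewrite o≗o′ l = eval-cong (t (o′ l)) o≗o′

  -- Every question gets its own fair coin, whatever coordinate the label stands for.
  rejection : BitTree L → ℚ
  rejection (leaf b)  = 𝟙 (not b)
  rejection (ask l t) = avg (rejection (t false)) (rejection (t true))

  -- `F` collects the labels asked on the way from the root; a fresh tree asks no coordinate `φ l`
  -- twice on a branch.
  data Fresh {C : Set} (φ : L → C) (F : List L) : BitTree L → Set where
    leaf : ∀ b → Fresh φ F (leaf b)
    ask  : ∀ {l t} → All (λ l′ → φ l′ ≢ φ l) F → (∀ b → Fresh φ (l ∷ F) (t b)) → Fresh φ F (ask l t)

  -- If `ψ` identifies no labels beyond those that `φ` identifies, a repetition under `ψ` is also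
  -- one under `φ`. This carries freshness from shared letters to independent ones.
  fresh-map : ∀ {C C′ : Set} {φ : L → C} {ψ : L → C′} → (∀ {l l′} → ψ l ≡ ψ l′ → φ l ≡ φ l′) →
    ∀ {F t} → Fresh φ F t → Fresh ψ F t
  fresh-map ψ⇒φ (leaf b) = leaf b
  fresh-map ψ⇒φ (ask new fr) = ask (All.map (_∘ ψ⇒φ) new) (fresh-map ψ⇒φ ∘ fr)

  module _ {N} (φ : L → Fin N) where

    -- The coordinate of `l` was read earlier and is never read again, so a change of its bit goes
    -- unnoticed.
    eval-update : ∀ {F l t} z b → Fresh φ F t → l ∈ F →
      eval t (lookup (z [ φ l ]≔ b) ∘ φ) ≡ eval t (lookup z ∘ φ)
    eval-update z b (leaf _) l∈F = refl
    eval-update {l = l} z b (ask {l′} new fr) l∈F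
      rewrite Vec.lookup∘update′ (All.lookup new l∈F ∘ sym) z b =
      eval-update z b (fr (lookup z (φ l′))) (there l∈F)

    -- Along a branch all coordinates differ, so the answers are independent fair coins. The right
    -- side does not mention `φ`: this is why shared and independent letters look the same to a
    -- fresh tree.
    𝔼-eval : ∀ {F t} → Fresh φ F t → 𝔼 (λ z → 𝟙 (not (eval t (lookup z ∘ φ)))) ≡ rejection t
    𝔼-eval (leaf b) = 𝔼-const {N} _
    𝔼-eval {t = ask l t} (ask new fr) =
      trans (𝔼-resample (φ l) _) (cong₂ avg (branch false) (branch true))
      where
      branch : ∀ b → 𝔼 (λ z → 𝟙 (not (eval (ask l t) (lookup (z [ φ l ]≔ b) ∘ φ)))) ≡ rejection (t b)
      branch b = trans (𝔼-cong (λ z → cong (𝟙 ∘ not) (answer z))) (𝔼-eval (fr b))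
        where
        answer : ∀ z → eval (ask l t) (lookup (z [ φ l ]≔ b) ∘ φ) ≡ eval (t b) (lookup z ∘ φ)
        answer z rewrite Vec.lookup∘update (φ l) z b = eval-update z b (fr b) (here refl)

-- Insertion-deletion distance of random strings

-- `stop` accepts every remaining budget, so the index is an upper bound on the number of deletions
-- and insertions.
data Edits : List Bool → List Bool → ℕ → Set where
  stop   : ∀ {e} → Edits [] [] e
  keep   : ∀ {x xs ys e} → Edits xs ys e → Edits (x ∷ xs) (x ∷ ys) e
  delete : ∀ {x xs ys e} → Edits xs ys e → Edits (x ∷ xs) ys (suc e)
  insert : ∀ {y xs ys e} → Edits xs ys e → Edits xs (y ∷ ys) (suc e)

weaken : ∀ {xs ys e f} → e ≤ f → Edits xs ys e → Edits xs ys f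
weaken e≤f stop = stop
weaken e≤f (keep p) = keep (weaken e≤f p)
weaken (s≤s e≤f) (delete p) = delete (weaken e≤f p)
weaken (s≤s e≤f) (insert p) = insert (weaken e≤f p)

Edits-sym : ∀ {xs ys e} → Edits xs ys e → Edits ys xs e
Edits-sym stop = stop
Edits-sym (keep p) = keep (Edits-sym p)
Edits-sym (delete p) = insert (Edits-sym p)
Edits-sym (insert p) = delete (Edits-sym p)

Edits-trans : ∀ {xs ys zs e f} → Edits xs ys e → Edits ys zs f → Edits xs zs (e + f)
Edits-trans stop stop = stop
Edits-trans {e = e} p (insert {e = f} q) rewrite ℕ.+-suc e f = insert (Edits-trans p q)
Edits-trans (delete p) stop = delete (Edits-trans p stop)
Edits-trans (delete p) q@(keep _) = delete (Edits-trans p q)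
Edits-trans (delete p) q@(delete _) = delete (Edits-trans p q)
Edits-trans (keep p) (keep q) = keep (Edits-trans p q)
Edits-trans {e = e} (keep p) (delete {e = f} q) rewrite ℕ.+-suc e f = delete (Edits-trans p q)
Edits-trans (insert p) (keep q) = insert (Edits-trans p q)
-- A letter inserted and then deleted cancels, and the two edits saved are returned by weakening.
Edits-trans (insert {e = e} p) (delete {e = f} q) =
  weaken (ℕ.m≤n⇒m≤1+n (ℕ.+-monoʳ-≤ e (ℕ.n≤1+n f))) (Edits-trans p q)

-- A changed symbol costs the truestring at most one deletion and one insertion, whence the factor
-- 2.
truestring-edits : ∀ {n} (w w′ : Vec Symbol n) →
  Edits (truestring w) (truestring w′) (2 * hamming w w′)
truestring-edits [] [] = stop
truestring-edits (x ∷ w) (x′ ∷ w′) with x ≟ x′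
truestring-edits (just x ∷ w) (_ ∷ w′) | yes refl = keep (truestring-edits w w′)
truestring-edits (nothing ∷ w) (_ ∷ w′) | yes refl = truestring-edits w w′
... | no x≢x′ rewrite ℕ.*-suc 2 (hamming w w′) = change x x′ x≢x′
  where
  change : ∀ x x′ → x ≢ x′ → Edits (truestring (x ∷ w)) (truestring (x′ ∷ w′)) (2 + 2 * hamming w w′)
  change (just _) (just _) _ = delete (insert (truestring-edits w w′))
  change (just _) nothing  _ = delete (weaken (ℕ.n≤1+n _) (truestring-edits w w′))
  change nothing  (just _) _ = insert (weaken (ℕ.n≤1+n _) (truestring-edits w w′))
  change nothing  nothing  x≢x = contradiction refl x≢x

-- Triangle inequality along `v`, `v′`, `w′`, `w`, where the middle two have the same truestring.
equivalent⇒edits : ∀ {n} (w v w′ v′ : Vec Symbol n) → TruestringEquivalent w′ v′ →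
  Edits (truestring v) (truestring w) (2 * pairDistance w v w′ v′)
equivalent⇒edits w v w′ v′ eq = subst (Edits _ _) total
  (Edits-trans (truestring-edits v v′)
    (subst (λ t → Edits t _ _) eq (Edits-sym (truestring-edits w w′))))
  where
  total : 2 * hamming v v′ + 2 * hamming w w′ ≡ 2 * (hamming w w′ + hamming v v′)
  total = trans (sym (ℕ.*-distribˡ-+ 2 (hamming v v′) (hamming w w′)))
                (cong (2 *_) (ℕ.+-comm (hamming v v′) (hamming w w′)))

-- A Boolean form of `Edits` that can be averaged over random strings. The alternatives in the last
-- clause are keep, delete and insert.
edits? : List Bool → List Bool → ℕ → Bool
edits? []       []       e       = true
edits? []       (y ∷ ys) zero    = false
edits? []       (y ∷ ys) (suc e) = edits? [] ys e
edits? (x ∷ xs) []       zero    = false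
edits? (x ∷ xs) []       (suc e) = edits? xs [] e
edits? (x ∷ xs) (y ∷ ys) zero    = does (x Bool.≟ y) ∧ edits? xs ys zero
edits? (x ∷ xs) (y ∷ ys) (suc e) =
  (does (x Bool.≟ y) ∧ edits? xs ys (suc e)) ∨ (edits? xs (y ∷ ys) e ∨ edits? (x ∷ xs) ys e)

edits?-complete : ∀ {xs ys e} → Edits xs ys e → edits? xs ys e ≡ true
edits?-complete stop = refl
edits?-complete (keep {x} {e = zero} p)
  rewrite dec-true (x Bool.≟ x) refl = edits?-complete p
edits?-complete (keep {x} {e = suc e} p)
  rewrite dec-true (x Bool.≟ x) refl | edits?-complete p = refl
edits?-complete (delete {ys = []} p) = edits?-complete p
edits?-complete (delete {x} {xs} {y ∷ ys} p)
  rewrite edits?-complete p = Bool.∨-zeroʳ _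
edits?-complete (insert {xs = []} p) = edits?-complete p
edits?-complete (insert {y} {x ∷ xs} {ys} {e} p)
  rewrite edits?-complete p | Bool.∨-zeroʳ (edits? xs (y ∷ ys) e) = Bool.∨-zeroʳ _

¾ 7ℚ : ℚ
¾ = ℤ.+ 3 ℚ./ 4
7ℚ = ℤ.+ 7 ℚ./ 1

-- This is (3/4)^ℓ · 7^e.
bound : ℕ → ℕ → ℚ
bound zero    zero    = 1ℚ
bound zero    (suc e) = 7ℚ ℚ.* bound zero e
bound (suc ℓ) e       = ¾ ℚ.* bound ℓ e

bound-suc : ∀ ℓ e → bound ℓ (suc e) ≡ 7ℚ ℚ.* bound ℓ e
bound-suc zero e = refl
bound-suc (suc ℓ) e = trans (cong (¾ ℚ.*_) (bound-suc ℓ e))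
  (solve 1 (λ b → con ¾ :* (con 7ℚ :* b) := con 7ℚ :* (con ¾ :* b)) refl (bound ℓ e))
  where open +-*-Solver

bound≥0 : ∀ ℓ e → 0ℚ ℚ.≤ bound ℓ e
bound≥0 zero zero = ℚ.≤ᵇ⇒≤ _
bound≥0 zero (suc e) = ℚ.*-monoˡ-≤-nonNeg 7ℚ (bound≥0 zero e)
bound≥0 (suc ℓ) e = ℚ.*-monoˡ-≤-nonNeg ¾ (bound≥0 ℓ e)

scale : ∀ c a b → 0ℚ ℚ.≤ b → c ℚ.≤ a → c ℚ.* b ℚ.≤ a ℚ.* b
scale c a b 0≤b c≤a = ℚ.*-monoʳ-≤-nonNeg b {{ℚ.nonNegative 0≤b}} c≤a

bound-grows : ∀ a ℓ e → 1ℚ ℚ.≤ a → bound ℓ e ℚ.≤ a ℚ.* bound ℓ e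
bound-grows a ℓ e 1≤a =
  subst (ℚ._≤ a ℚ.* bound ℓ e) (ℚ.*-identityˡ (bound ℓ e)) (scale 1ℚ a (bound ℓ e) (bound≥0 ℓ e) 1≤a)

𝟙-∨ : ∀ a b → 𝟙 (a ∨ b) ℚ.≤ 𝟙 a ℚ.+ 𝟙 b
𝟙-∨ true  true  = ℚ.≤ᵇ⇒≤ _
𝟙-∨ true  false = ℚ.≤-refl
𝟙-∨ false true  = ℚ.≤-refl
𝟙-∨ false false = ℚ.≤-refl

-- The first bit is independent of the rest and agrees with `y` half of the time.
𝔼-head-≡ : ∀ {d} (y : Bool) (A : Vec Bool d → Bool) →
  𝔼 (λ z → 𝟙 (does (head z Bool.≟ y) ∧ A (tail z))) ≡ ½ ℚ.* 𝔼 (𝟙 ∘ A)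
𝔼-head-≡ {d} false A =
  trans (cong (avg (𝔼 (𝟙 ∘ A))) (𝔼-const {d} 0ℚ)) (cong (½ ℚ.*_) (ℚ.+-identityʳ (𝔼 (𝟙 ∘ A))))
𝔼-head-≡ {d} true A =
  trans (cong (λ a → avg a (𝔼 (𝟙 ∘ A))) (𝔼-const {d} 0ℚ)) (cong (½ ℚ.*_) (ℚ.+-identityˡ (𝔼 (𝟙 ∘ A))))

within : ∀ {d} → List Bool → ℕ → Vec Bool d → ℚ
within ys e z = 𝟙 (edits? (toList z) ys e)

-- The weights ¾ and 7 are a solution of ½ / ¾ + 1 / 7 + 1 / (¾ · 7) ≤ 1, the three terms being
-- the cases keep, delete and insert.
𝔼-edits : ∀ d ys e → 𝔼 {d} (within ys e) ℚ.≤ bound (List.length ys) e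
𝔼-edits zero [] zero = ℚ.≤-refl
𝔼-edits zero [] (suc e) =
  ℚ.≤-trans (𝔼-edits zero [] e) (bound-grows 7ℚ 0 e (ℚ.≤ᵇ⇒≤ {1ℚ} {7ℚ} _))
𝔼-edits zero (y ∷ ys) zero = bound≥0 (suc (List.length ys)) zero
𝔼-edits zero (y ∷ ys) (suc e) = begin
  within ys e []                     ≤⟨ 𝔼-edits zero ys e ⟩
  b                                  ≤⟨ bound-grows (¾ ℚ.* 7ℚ) (List.length ys) e (ℚ.≤ᵇ⇒≤ {1ℚ} {¾ ℚ.* 7ℚ} _) ⟩
  (¾ ℚ.* 7ℚ) ℚ.* b                   ≡⟨ ℚ.*-assoc ¾ 7ℚ b ⟩
  ¾ ℚ.* (7ℚ ℚ.* b)                   ≡⟨ cong (¾ ℚ.*_) (bound-suc (List.length ys) e) ⟨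
  ¾ ℚ.* bound (List.length ys) (suc e) ∎
  where
  open ℚ.≤-Reasoning
  b = bound (List.length ys) e
𝔼-edits (suc d) [] zero = begin
  𝔼 {suc d} (within [] 0)
    ≤⟨ 𝔼-mono {suc d} {within [] 0} {λ _ → 1ℚ} (λ z → 𝟙≤1 (edits? (toList z) [] 0)) ⟩
  𝔼 {suc d} (λ _ → 1ℚ)   ≡⟨ 𝔼-const {suc d} 1ℚ ⟩
  1ℚ                     ∎
  where open ℚ.≤-Reasoning
𝔼-edits (suc d) [] (suc e) = begin
  avg short short        ≡⟨ avg-idem short ⟩
  short                  ≤⟨ 𝔼-edits d [] e ⟩
  bound 0 e              ≤⟨ bound-grows 7ℚ 0 e (ℚ.≤ᵇ⇒≤ {1ℚ} {7ℚ} _) ⟩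
  7ℚ ℚ.* bound 0 e       ∎
  where
  open ℚ.≤-Reasoning
  short : ℚ
  short = 𝔼 {d} (within [] e)
𝔼-edits (suc d) (y ∷ ys) zero = begin
  𝔼 {suc d} (within (y ∷ ys) 0)
    ≡⟨ 𝔼-cong {suc d} {within (y ∷ ys) 0} {kept} (λ { (x ∷ z) → refl }) ⟩
  𝔼 {suc d} kept
    ≡⟨ 𝔼-head-≡ {d} y (λ z → edits? (toList z) ys 0) ⟩
  ½ ℚ.* 𝔼 {d} (within ys 0)
    ≤⟨ ℚ.*-monoˡ-≤-nonNeg ½ (𝔼-edits d ys 0) ⟩
  ½ ℚ.* b
    ≤⟨ scale ½ ¾ b (bound≥0 (List.length ys) 0) (ℚ.≤ᵇ⇒≤ {½} {¾} _) ⟩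
  ¾ ℚ.* b ∎
  where
  open ℚ.≤-Reasoning
  b = bound (List.length ys) 0
  kept : Vec Bool (suc d) → ℚ
  kept z = 𝟙 (does (head z Bool.≟ y) ∧ edits? (toList (tail z)) ys 0)
𝔼-edits (suc d) (y ∷ ys) (suc e) = begin
  𝔼 {suc d} (within (y ∷ ys) (suc e))
    ≤⟨ 𝔼-mono {suc d} {within (y ∷ ys) (suc e)} {λ z → kept z ℚ.+ (deleted z ℚ.+ inserted z)} split ⟩
  𝔼 {suc d} (λ z → kept z ℚ.+ (deleted z ℚ.+ inserted z))
    ≡⟨ 𝔼-+ {suc d} kept (λ z → deleted z ℚ.+ inserted z) ⟩
  𝔼 {suc d} kept ℚ.+ 𝔼 {suc d} (λ z → deleted z ℚ.+ inserted z)
    ≡⟨ cong₂ ℚ._+_ (𝔼-head-≡ {d} y (λ z → edits? (toList z) ys (suc e)))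
         (trans (𝔼-+ {suc d} deleted inserted)
                (cong (ℚ._+ 𝔼 {suc d} inserted) (avg-idem (𝔼 {d} (within (y ∷ ys) e))))) ⟩
  ½ ℚ.* 𝔼 {d} (within ys (suc e)) ℚ.+ (𝔼 {d} (within (y ∷ ys) e) ℚ.+ 𝔼 {suc d} inserted)
    ≤⟨ ℚ.+-mono-≤ (ℚ.*-monoˡ-≤-nonNeg ½ (𝔼-edits d ys (suc e)))
         (ℚ.+-mono-≤ (𝔼-edits d (y ∷ ys) e) (𝔼-edits (suc d) ys e)) ⟩
  ½ ℚ.* bound (List.length ys) (suc e) ℚ.+ (¾ ℚ.* b ℚ.+ b)
    ≡⟨ cong (λ a → ½ ℚ.* a ℚ.+ (¾ ℚ.* b ℚ.+ b)) (bound-suc (List.length ys) e) ⟩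
  ½ ℚ.* (7ℚ ℚ.* b) ℚ.+ (¾ ℚ.* b ℚ.+ b)
    ≡⟨ solve 1 (λ b → con ½ :* (con 7ℚ :* b) :+ (con ¾ :* b :+ b)
                    := con ¾ :* (con 7ℚ :* b)) refl b ⟩
  ¾ ℚ.* (7ℚ ℚ.* b)
    ≡⟨ cong (¾ ℚ.*_) (bound-suc (List.length ys) e) ⟨
  ¾ ℚ.* bound (List.length ys) (suc e) ∎
  where
  open ℚ.≤-Reasoning
  open +-*-Solver
  b = bound (List.length ys) e
  kept inserted deleted : Vec Bool (suc d) → ℚ
  kept z = 𝟙 (does (head z Bool.≟ y) ∧ edits? (toList (tail z)) ys (suc e))
  inserted = within ys e
  deleted = within (y ∷ ys) e ∘ tail
  split : ∀ z → within (y ∷ ys) (suc e) z ℚ.≤ kept z ℚ.+ (deleted z ℚ.+ inserted z)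
  split (x ∷ z) = ℚ.≤-trans
    (𝟙-∨ (does (x Bool.≟ y) ∧ edits? (toList z) ys (suc e))
         (edits? (toList z) (y ∷ ys) e ∨ edits? (x ∷ toList z) ys e))
    (ℚ.+-monoʳ-≤ (kept (x ∷ z)) (𝟙-∨ (edits? (toList z) (y ∷ ys) e) (edits? (x ∷ toList z) ys e)))

¾^ : ℕ → ℚ
¾^ ℓ = bound ℓ 0

-- ¾⁷ · 7 < 1
bound-absorb : ∀ e t → bound (e * 7 + t) e ℚ.≤ ¾^ t
bound-absorb zero t = ℚ.≤-refl
bound-absorb (suc e) t = begin
  ¾ ℚ.* (¾ ℚ.* (¾ ℚ.* (¾ ℚ.* (¾ ℚ.* (¾ ℚ.* (¾ ℚ.* bound ℓ (suc e)))))))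
    ≡⟨ cong (λ a → ¾ ℚ.* (¾ ℚ.* (¾ ℚ.* (¾ ℚ.* (¾ ℚ.* (¾ ℚ.* (¾ ℚ.* a))))))) (bound-suc ℓ e) ⟩
  ¾ ℚ.* (¾ ℚ.* (¾ ℚ.* (¾ ℚ.* (¾ ℚ.* (¾ ℚ.* (¾ ℚ.* (7ℚ ℚ.* bound ℓ e)))))))
    ≡⟨ solve 1 (λ b → con ¾ :* (con ¾ :* (con ¾ :* (con ¾ :* (con ¾ :* (con ¾ :* (con ¾ :*
         (con 7ℚ :* b))))))) := con c :* b) refl (bound ℓ e) ⟩
  c ℚ.* bound ℓ e
    ≤⟨ scale c 1ℚ (bound ℓ e) (bound≥0 ℓ e) (ℚ.≤ᵇ⇒≤ {c} {1ℚ} _) ⟩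
  1ℚ ℚ.* bound ℓ e
    ≡⟨ ℚ.*-identityˡ (bound ℓ e) ⟩
  bound ℓ e
    ≤⟨ bound-absorb e t ⟩
  ¾^ t ∎
  where
  open ℚ.≤-Reasoning
  open +-*-Solver
  ℓ = e * 7 + t
  c = ¾ ℚ.* ¾ ℚ.* ¾ ℚ.* ¾ ℚ.* ¾ ℚ.* ¾ ℚ.* ¾ ℚ.* 7ℚ

⅛ : ℚ
⅛ = ℤ.+ 1 ℚ./ 8

-- (3/4)^8 is about 0.100 and (3/4)^7 about 0.133, so 8 is the least exponent that works.
¾^8≤⅛ : ∀ t → ¾^ (8 + t) ℚ.≤ ⅛
¾^8≤⅛ zero = ℚ.≤ᵇ⇒≤ {¾^ 8} {⅛} _
¾^8≤⅛ (suc t) = ℚ.≤-trans (ℚ.*-monoˡ-≤-nonNeg ¾ (¾^8≤⅛ t)) (ℚ.≤ᵇ⇒≤ {¾ ℚ.* ⅛} {⅛} _)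

bound-small : ∀ e t → bound (e * 7 + (8 + t)) e ℚ.≤ ⅛
bound-small e t = ℚ.≤-trans (bound-absorb e (8 + t)) (¾^8≤⅛ t)

-- The hard instances

-- A function on all of ℕ lets windows be shifted by plain arithmetic on indices; the default
-- `false` lies past the end of the string.
letter : ∀ {N} → Vec Bool N → ℕ → Bool
letter []      _       = false
letter (b ∷ z) zero    = b
letter (b ∷ z) (suc k) = letter z k

letter-fromℕ< : ∀ {N} (z : Vec Bool N) {k} (k<N : k < N) → letter z k ≡ lookup z (fromℕ< k<N)
letter-fromℕ< (b ∷ z) {zero}  (s≤s k<N) = refl
letter-fromℕ< (b ∷ z) {suc k} (s≤s k<N) = letter-fromℕ< z k<N

applyUpTo-++ : ∀ {A : Set} (f : ℕ → A) a b →
  applyUpTo f (a + b) ≡ applyUpTo f a List.++ applyUpTo (f ∘ (a +_)) b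
applyUpTo-++ f zero b = refl
applyUpTo-++ f (suc a) b = cong (f 0 ∷_) (applyUpTo-++ (f ∘ suc) a b)

applyUpTo-cong : ∀ {A : Set} {f g : ℕ → A} → (∀ k → f k ≡ g k) → ∀ a → applyUpTo f a ≡ applyUpTo g a
applyUpTo-cong f≗g zero = refl
applyUpTo-cong f≗g (suc a) = cong₂ _∷_ (f≗g 0) (applyUpTo-cong (f≗g ∘ suc) a)

toList-tabulate-toℕ : ∀ {A : Set} (f : ℕ → A) k → toList (tabulate {n = k} (f ∘ toℕ)) ≡ applyUpTo f k
toList-tabulate-toℕ f zero = refl
toList-tabulate-toℕ f (suc k) = cong (f 0 ∷_) (toList-tabulate-toℕ (f ∘ suc) k)

truestring-++ : ∀ {a b} (x : Vec Symbol a) (y : Vec Symbol b) →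
  truestring (x Vec.++ y) ≡ truestring x List.++ truestring y
truestring-++ x y = trans (cong catMaybes (Vec.toList-++ x y)) (List.catMaybes-++ (toList x) (toList y))

truestring-just : ∀ {a} (z : Vec Bool a) → truestring (Vec.map just z) ≡ toList z
truestring-just []      = refl
truestring-just (b ∷ z) = cong (b ∷_) (truestring-just z)

truestring-blank : ∀ a → truestring (replicate a nothing) ≡ []
truestring-blank zero    = refl
truestring-blank (suc a) = truestring-blank a

sparse : ∀ {m S} → Fin m → Vec Symbol S → Vec Symbol (m * S)
sparse {m} {S} r x = concat (replicate m (replicate S nothing) [ r ]≔ x)

truestring-sparse : ∀ {m S} (r : Fin m) (x : Vec Symbol S) → truestring (sparse r x) ≡ truestring x
truestring-sparse {suc m} {S} zero x = begin
  truestring (x Vec.++ concat (replicate m (replicate S nothing)))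
    ≡⟨ truestring-++ x _ ⟩
  truestring x List.++ truestring (concat (replicate m (replicate S nothing)))
    ≡⟨ cong (truestring x List.++_) (blank m) ⟩
  truestring x List.++ []
    ≡⟨ List.++-identityʳ _ ⟩
  truestring x ∎
  where
  open ≡-Reasoning
  blank : ∀ m → truestring (concat (replicate m (replicate S nothing))) ≡ []
  blank zero    = refl
  blank (suc m) = trans (truestring-++ (replicate S nothing) _) (cong₂ List._++_ (truestring-blank S) (blank m))
truestring-sparse {suc m} {S} (suc r) x =
  trans (truestring-++ (replicate S nothing) _) (cong₂ List._++_ (truestring-blank S) (truestring-sparse r x))

lookup-sparse : ∀ {m S} (r : Fin m) (x : Vec Symbol S) p → quotient {m} S p ≢ r →
  lookup (sparse r x) p ≡ nothing
lookup-sparse {m} {S} r x p p≢r = begin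
  lookup (concat blocks) p
    ≡⟨ cong (lookup (concat blocks)) (Fin.combine-remQuot {m} S p) ⟨
  lookup (concat blocks) (combine (quotient {m} S p) (remainder {m} S p))
    ≡⟨ Vec.lookup-concat blocks (quotient {m} S p) (remainder {m} S p) ⟩
  lookup (lookup blocks (quotient {m} S p)) (remainder {m} S p)
    ≡⟨ cong (λ y → lookup y (remainder {m} S p))
         (trans (Vec.lookup∘update′ p≢r (replicate m (replicate S nothing)) x)
                (Vec.lookup-replicate (quotient {m} S p) (replicate S nothing))) ⟩
  lookup (replicate S nothing) (remainder {m} S p)
    ≡⟨ Vec.lookup-replicate (remainder {m} S p) nothing ⟩
  nothing ∎
  where
  open ≡-Reasoning
  blocks = replicate m (replicate S nothing) [ r ]≔ x

-- A letter keeps the position given by its index and the other positions are blank. Hence the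
-- `suffix` of `f ∘ (D +_)` begins with `f (D + s)`, just after the window of length `D` that starts
-- at `s`.
prefix suffix : ℕ → ∀ S → (ℕ → Bool) → Vec Symbol S
prefix zero    S       f = replicate S nothing
prefix (suc s) zero    f = []
prefix (suc s) (suc S) f = just (f 0) ∷ prefix s S (f ∘ suc)
suffix zero    S       f = Vec.map just (tabulate (f ∘ toℕ))
suffix (suc s) zero    f = []
suffix (suc s) (suc S) f = nothing ∷ suffix s S (f ∘ suc)

truestring-prefix : ∀ {s S} f → s ≤ S → truestring (prefix s S f) ≡ applyUpTo f s
truestring-prefix {S = S} f z≤n = truestring-blank S
truestring-prefix f (s≤s s≤S) = cong (f 0 ∷_) (truestring-prefix (f ∘ suc) s≤S)

truestring-suffix : ∀ {s S} f → s ≤ S → truestring (suffix s S f) ≡ applyUpTo (f ∘ (s +_)) (S ∸ s)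
truestring-suffix {S = S} f z≤n = trans (truestring-just _) (toList-tabulate-toℕ f S)
truestring-suffix f (s≤s s≤S) = truestring-suffix (f ∘ suc) s≤S

module Construction (m S D : ℕ) where

  U n : ℕ
  U = m * S
  n = U + (D + U)

  -- Left and right blocks of the same number are not distinguished, since one number `r` locates
  -- the hidden letters on both sides.
  zone : Fin n → Fin m ⊎ Fin D
  zone p = [ inj₁ ∘ quotient {m} S , [ inj₂ , inj₁ ∘ quotient {m} S ]′ ∘ splitAt D ]′ (splitAt U p)

  assemble : Vec Symbol U → Vec Bool D → Vec Symbol U → Vec Symbol n
  assemble x y z = x Vec.++ (Vec.map just y Vec.++ z)

  truestring-assemble : ∀ x y z →
    truestring (assemble x y z) ≡ truestring x List.++ (toList y List.++ truestring z)
  truestring-assemble x y z = trans (truestring-++ x _) (cong (truestring x List.++_)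
    (trans (truestring-++ (Vec.map just y) z) (cong (List._++ truestring z) (truestring-just y))))

  Blank : Fin m → Vec Symbol U → Set
  Blank c x = ∀ p → quotient {m} S p ≡ c → lookup x p ≡ nothing

  lookup-assemble : ∀ x y z p →
    [ (λ c → Blank c x → Blank c z → lookup (assemble x y z) p ≡ nothing)
    , (λ j → lookup (assemble x y z) p ≡ just (lookup y j)) ]′ (zone p)
  lookup-assemble x y z p rewrite Vec.lookup-splitAt U x (Vec.map just y Vec.++ z) p
    with splitAt U p
  ... | inj₁ p′ = λ x-blank _ → x-blank p′ refl
  ... | inj₂ p′ rewrite Vec.lookup-splitAt D (Vec.map just y) z p′ with splitAt D p′
  ...   | inj₁ j  = Vec.lookup-map j just y
  ...   | inj₂ p″ = λ _ z-blank → z-blank p″ refl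

  shifted : Fin m → ℕ → (ℕ → Bool) → Vec Symbol n
  shifted r s f = assemble (sparse r (prefix s S f)) (tabulate (λ j → f (s + toℕ j)))
                           (sparse r (suffix s S (f ∘ (D +_))))

  -- Prefix, window and suffix are consecutive intervals that together make up the whole of
  -- `f 0 .. f (S + D - 1)`, so the truestring does not depend on `s`.
  truestring-shifted : ∀ r {s} f → s ≤ S → truestring (shifted r s f) ≡ applyUpTo f (S + D)
  truestring-shifted r {s} f s≤S = begin
    truestring (shifted r s f)
      ≡⟨ truestring-assemble (sparse r (prefix s S f)) _ (sparse r (suffix s S (f ∘ (D +_)))) ⟩
    truestring (sparse r (prefix s S f)) List.++ (toList (tabulate {n = D} (λ j → f (s + toℕ j))) List.++
      truestring (sparse r (suffix s S (f ∘ (D +_)))))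
      ≡⟨ cong₂ List._++_ (trans (truestring-sparse r _) (truestring-prefix f s≤S))
           (cong₂ List._++_ (toList-tabulate-toℕ (f ∘ (s +_)) D)
             (trans (truestring-sparse r _) (truestring-suffix (f ∘ (D +_)) s≤S))) ⟩
    applyUpTo f s List.++ (applyUpTo (f ∘ (s +_)) D List.++ applyUpTo (λ k → f (D + (s + k))) (S ∸ s))
      ≡⟨ cong (λ t → applyUpTo f s List.++ (applyUpTo (f ∘ (s +_)) D List.++ t))
           (applyUpTo-cong (λ k → cong f (swap k)) (S ∸ s)) ⟩
    applyUpTo f s List.++ (applyUpTo (f ∘ (s +_)) D List.++ applyUpTo (λ k → f (s + (D + k))) (S ∸ s))
      ≡⟨ cong (applyUpTo f s List.++_) (applyUpTo-++ (f ∘ (s +_)) D (S ∸ s)) ⟨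
    applyUpTo f s List.++ applyUpTo (f ∘ (s +_)) (D + (S ∸ s))
      ≡⟨ applyUpTo-++ f s (D + (S ∸ s)) ⟨
    applyUpTo f (s + (D + (S ∸ s)))
      ≡⟨ cong (applyUpTo f) total ⟩
    applyUpTo f (S + D) ∎
    where
    open ≡-Reasoning
    swap : ∀ k → D + (s + k) ≡ s + (D + k)
    swap k = trans (sym (ℕ.+-assoc D s k)) (trans (cong (_+ k) (ℕ.+-comm D s)) (ℕ.+-assoc s D k))
    total : s + (D + (S ∸ s)) ≡ S + D
    total = begin
      s + (D + (S ∸ s)) ≡⟨ swap (S ∸ s) ⟨
      D + (s + (S ∸ s)) ≡⟨ cong (D +_) (ℕ.m+[n∸m]≡n s≤S) ⟩
      D + S             ≡⟨ ℕ.+-comm D S ⟩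
      S + D             ∎

  unsynchronised : Vec Bool D → Vec Symbol n
  unsynchronised x = assemble (replicate U nothing) x (replicate U nothing)

  truestring-unsynchronised : ∀ x → truestring (unsynchronised x) ≡ toList x
  truestring-unsynchronised x =
    trans (truestring-assemble (replicate U nothing) x (replicate U nothing))
      (trans (cong₂ (λ a b → a List.++ (toList x List.++ b)) (truestring-blank U) (truestring-blank U))
             (List.++-identityʳ _))

  -- Simulating a tester by a tree of random bits

  Site : Set
  Site = Fin D ⊎ Fin D

  -- What matters about a query: the number of the block it looks into, or else the middle position
  -- it reads, tagged by the string. Block events forget the string because both strings of a
  -- shifted pair use the same `r`.
  Event : Set
  Event = Fin m ⊎ Site

  zone₁ zone₂ : Fin n → Event
  zone₁ p = Sum.map₂ inj₁ (zone p)
  zone₂ p = Sum.map₂ inj₂ (zone p)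

  events : DecisionTree n → Vec Symbol n → Vec Symbol n → List Event
  events (output b)   w v = []
  events (query₁ p t) w v = zone₁ p ∷ events (t (lookup w p)) w v
  events (query₂ p t) w v = zone₂ p ∷ events (t (lookup v p)) w v

  length-events : ∀ t w v → length (events t w v) ≡ queries t w v
  length-events (output b)   w v = refl
  length-events (query₁ p t) w v = cong suc (length-events (t (lookup w p)) w v)
  length-events (query₂ p t) w v = cong suc (length-events (t (lookup v p)) w v)

  -- All that the simulation assumes about an instance; nothing is promised about the contents of
  -- block `r`.
  Answers : Fin m → (Site → Bool) → Event → Symbol → Set
  Answers r o (inj₁ c) a = c ≢ r → a ≡ nothing
  Answers r o (inj₂ l) a = a ≡ just (o l)

  module Simulation {N} (r : Fin m) (φ : Site → Fin N) where

    -- Sites read so far with their answers. A site whose coordinate under `φ` occurs here is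
    -- answered from memory, which keeps the simulating tree fresh.
    Memory : Set
    Memory = List (Site × Bool)

    -- A visit to block r is answered by accepting, which only weakens a lower bound on rejection.
    respond : Memory → Event → (Memory → Symbol → BitTree Site) → BitTree Site
    respond K (inj₁ c) κ = if does (c Fin.≟ r) then leaf true else κ K nothing
    respond K (inj₂ l) κ with any? (λ e → φ (proj₁ e) Fin.≟ φ l) K
    ... | yes known = κ K (just (proj₂ (Any.lookup known)))
    ... | no _      = ask l (λ b → κ ((l , b) ∷ K) (just b))

    simulate : Memory → DecisionTree n → BitTree Site
    simulate K (output b)   = leaf b
    simulate K (query₁ p t) = respond K (zone₁ p) (λ K′ a → simulate K′ (t a))
    simulate K (query₂ p t) = respond K (zone₂ p) (λ K′ a → simulate K′ (t a))

    respond-fresh : ∀ K e {κ} → (∀ K′ a → Fresh φ (List.map proj₁ K′) (κ K′ a)) →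
      Fresh φ (List.map proj₁ K) (respond K e κ)
    respond-fresh K (inj₁ c) κ-fresh with does (c Fin.≟ r)
    ... | true  = leaf true
    ... | false = κ-fresh K nothing
    respond-fresh K (inj₂ l) κ-fresh with any? (λ e → φ (proj₁ e) Fin.≟ φ l) K
    ... | yes known = κ-fresh K _
    ... | no new    = ask (All.map⁺ (All.¬Any⇒All¬ K new)) (λ b → κ-fresh ((l , b) ∷ K) (just b))

    simulate-fresh : ∀ K t → Fresh φ (List.map proj₁ K) (simulate K t)
    simulate-fresh K (output b)   = leaf b
    simulate-fresh K (query₁ p t) = respond-fresh K (zone₁ p) (λ K′ a → simulate-fresh K′ (t a))
    simulate-fresh K (query₂ p t) = respond-fresh K (zone₂ p) (λ K′ a → simulate-fresh K′ (t a))

    -- `P` delimits the events of the run on which `o` has to respect `φ`. For shifted pairs `o`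
    -- factors through `φ` and `P` can be trivial; for independent strings `P` is membership in the
    -- trace, and coherence follows from the absence of collisions.
    module _ (o : Site → Bool) (P : Event → Set)
             (coherent : ∀ {l l′} → P (inj₂ l) → P (inj₂ l′) → φ l ≡ φ l′ → o l ≡ o l′) where

      Consistent : Memory → Set
      Consistent = All (λ e → P (inj₂ (proj₁ e)) × o (proj₁ e) ≡ proj₂ e)

      respond-correct : ∀ {K e a κ} → Consistent K → P e → Answers r o e a →
        (P (inj₁ r) × eval (respond K e κ) o ≡ true) ⊎
        Σ[ K′ ∈ Memory ] (Consistent K′ × eval (respond K e κ) o ≡ eval (κ K′ a) o)
      respond-correct {K} {inj₁ c} K-ok Pe ans with c Fin.≟ r
      ... | yes refl = inj₁ (Pe , refl)
      ... | no c≢r rewrite ans c≢r = inj₂ (K , K-ok , refl)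
      respond-correct {K} {inj₂ l} {κ = κ} K-ok Pe refl with any? (λ e → φ (proj₁ e) Fin.≟ φ l) K
      ... | no new = inj₂ ((l , o l) ∷ K , (Pe , refl) ∷ K-ok , refl)
      -- The remembered bit may belong to another site with the same coordinate; `coherent` makes it
      -- the right answer for `l` too.
      ... | yes known =
        inj₂ (K , K-ok , cong (λ b → eval (κ K (just b)) o)
          (trans (sym (proj₂ entry)) (coherent (proj₁ entry) Pe (All.lookupAny K-ok known .proj₂))))
        where entry = All.lookupAny K-ok known .proj₁

      module _ {w v : Vec Symbol n}
               (w-answers : ∀ p → Answers r o (zone₁ p) (lookup w p))
               (v-answers : ∀ p → Answers r o (zone₂ p) (lookup v p)) where

        -- Until the run reaches block `r`, remembered bits are true answers and every block looked
        -- into is blank, so the simulation follows the same path as the run.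
        simulate-correct : ∀ t {K} → Consistent K → All P (events t w v) →
          (P (inj₁ r) × eval (simulate K t) o ≡ true) ⊎ eval (simulate K t) o ≡ run t w v
        simulate-correct (output b) K-ok _ = inj₂ refl
        simulate-correct (query₁ p t) K-ok (Pe ∷ Pes)
          with respond-correct {κ = λ K′ a → simulate K′ (t a)} K-ok Pe (w-answers p)
        ... | inj₁ hit = inj₁ hit
        ... | inj₂ (K′ , K′-ok , eq) rewrite eq = simulate-correct (t (lookup w p)) K′-ok Pes
        simulate-correct (query₂ p t) K-ok (Pe ∷ Pes)
          with respond-correct {κ = λ K′ a → simulate K′ (t a)} K-ok Pe (v-answers p)
        ... | inj₁ hit = inj₁ hit
        ... | inj₂ (K′ , K′-ok , eq) rewrite eq = simulate-correct (t (lookup v p)) K′-ok Pes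

-- Natural numbers as rationals, double averages and counting

private
  -- Division normalises by a gcd that is stuck on a variable; this literal form with denominator 1
  -- computes.
  integral : ℕ → ℚ
  integral k = ℚ.mkℚ (ℤ.+ k) 0 (Coprime.sym (Coprime.1-coprimeTo k))

  fromℕ≡integral : ∀ k → fromℕ k ≡ integral k
  fromℕ≡integral k = ℚ.fromℚᵘ-toℚᵘ (integral k)

fromℕ-+ : ∀ a b → fromℕ (a + b) ≡ fromℕ a ℚ.+ fromℕ b
fromℕ-+ a b = begin
  fromℕ (a + b)                              ≡⟨ cong (ℚ._/ 1) (ℤ.pos-+ a b) ⟩
  (ℤ.+ a ℤ.+ ℤ.+ b) ℚ./ 1
    ≡⟨ cong (ℚ._/ 1) (cong₂ ℤ._+_ (ℤ.*-identityʳ (ℤ.+ a)) (ℤ.*-identityʳ (ℤ.+ b))) ⟨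
  (ℤ.+ a ℤ.* ℤ.+ 1 ℤ.+ ℤ.+ b ℤ.* ℤ.+ 1) ℚ./ 1        ≡⟨⟩
  integral a ℚ.+ integral b                  ≡⟨ cong₂ ℚ._+_ (fromℕ≡integral a) (fromℕ≡integral b) ⟨
  fromℕ a ℚ.+ fromℕ b                        ∎
  where open ≡-Reasoning

fromℕ-* : ∀ a b → fromℕ (a * b) ≡ fromℕ a ℚ.* fromℕ b
fromℕ-* a b = begin
  fromℕ (a * b)                              ≡⟨ cong (ℚ._/ 1) (ℤ.pos-* a b) ⟩
  integral a ℚ.* integral b                  ≡⟨ cong₂ ℚ._*_ (fromℕ≡integral a) (fromℕ≡integral b) ⟨
  fromℕ a ℚ.* fromℕ b                        ∎
  where open ≡-Reasoning

fromℕ-mono-≤ : ∀ {a b} → a ≤ b → fromℕ a ℚ.≤ fromℕ b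
fromℕ-mono-≤ {a} {b} a≤b = subst₂ ℚ._≤_ (sym (fromℕ≡integral a)) (sym (fromℕ≡integral b))
  (ℚ.*≤* (ℤ.*-monoʳ-≤-nonNeg (ℤ.+ 1) (ℤ.+≤+ a≤b)))

fromℕ-mono-< : ∀ {a b} → a < b → fromℕ a ℚ.< fromℕ b
fromℕ-mono-< {a} {b} a<b = subst₂ ℚ._<_ (sym (fromℕ≡integral a)) (sym (fromℕ≡integral b))
  (ℚ.*<* (ℤ.*-monoʳ-<-pos (ℤ.+ 1) (ℤ.+<+ a<b)))

fromℕ-sum : ∀ {k} (f : Fin k → ℕ) → fromℕ (∑ℕ.sum f) ≡ sum (fromℕ ∘ f)
fromℕ-sum {zero} f = refl
fromℕ-sum {suc k} f = trans (fromℕ-+ (f zero) _) (cong (fromℕ (f zero) ℚ.+_) (fromℕ-sum (f ∘ suc)))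

sum-const : ∀ k a → sum {k} (λ _ → a) ≡ fromℕ k ℚ.* a
sum-const zero a = sym (ℚ.*-zeroˡ a)
sum-const (suc k) a = begin
  a ℚ.+ sum {k} (λ _ → a)               ≡⟨ cong₂ ℚ._+_ (sym (ℚ.*-identityˡ a)) (sum-const k a) ⟩
  1ℚ ℚ.* a ℚ.+ fromℕ k ℚ.* a            ≡⟨ ℚ.*-distribʳ-+ a 1ℚ (fromℕ k) ⟨
  (1ℚ ℚ.+ fromℕ k) ℚ.* a                ≡⟨ cong (ℚ._* a) (fromℕ-+ 1 k) ⟨
  fromℕ (suc k) ℚ.* a                   ∎
  where open ≡-Reasoning

𝔼² : ∀ {M N} → (Vec Bool M → Vec Bool N → ℚ) → ℚ
𝔼² f = 𝔼 (λ x → 𝔼 (f x))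

𝔼²-mono : ∀ {M N} {f g : Vec Bool M → Vec Bool N → ℚ} → (∀ x y → f x y ℚ.≤ g x y) → 𝔼² f ℚ.≤ 𝔼² g
𝔼²-mono f≤g = 𝔼-mono (λ x → 𝔼-mono (f≤g x))

𝔼²-cong : ∀ {M N} {f g : Vec Bool M → Vec Bool N → ℚ} → (∀ x y → f x y ≡ g x y) → 𝔼² f ≡ 𝔼² g
𝔼²-cong f≡g = 𝔼-cong (λ x → 𝔼-cong (f≡g x))

𝔼²-const : ∀ {M N} a → 𝔼² {M} {N} (λ _ _ → a) ≡ a
𝔼²-const {M} {N} a = trans (𝔼-cong {M} (λ _ → 𝔼-const {N} a)) (𝔼-const {M} a)

𝔼²-+ : ∀ {M N} (f g : Vec Bool M → Vec Bool N → ℚ) → 𝔼² (λ x y → f x y ℚ.+ g x y) ≡ 𝔼² f ℚ.+ 𝔼² g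
𝔼²-+ f g = trans (𝔼-cong (λ x → 𝔼-+ (f x) (g x))) (𝔼-+ (λ x → 𝔼 (f x)) (λ x → 𝔼 (g x)))

𝔼²-* : ∀ {M N} a (f : Vec Bool M → Vec Bool N → ℚ) → 𝔼² (λ x y → a ℚ.* f x y) ≡ a ℚ.* 𝔼² f
𝔼²-* a f = trans (𝔼-cong (λ x → 𝔼-* a (f x))) (𝔼-* a (λ x → 𝔼 (f x)))

𝔼²-sum : ∀ {M N k} (g : Fin k → Vec Bool M → Vec Bool N → ℚ) →
  𝔼² (λ x y → sum (λ i → g i x y)) ≡ sum (λ i → 𝔼² (g i))
𝔼²-sum g = trans (𝔼-cong (λ x → 𝔼-sum (λ i → g i x))) (𝔼-sum (λ i x → 𝔼 (g i x)))

indicator : ∀ {P : Set} → Dec P → ℕ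
indicator P? = if does P? then 1 else 0

tally : ∀ {A : Set} → (A → ℕ) → List A → ℕ
tally f es = sumᴸ (List.map f es)

∈⇒≤tally : ∀ {A : Set} (f : A → ℕ) {e es} → e ∈ es → f e ≤ tally f es
∈⇒≤tally f (here refl) = ℕ.m≤m+n (f _) _
∈⇒≤tally f (there {x = e′} e∈es) = ℕ.≤-trans (∈⇒≤tally f e∈es) (ℕ.m≤n+m _ (f e′))

indicator-true : ∀ {P : Set} (P? : Dec P) → P → 1 ≤ indicator P?
indicator-true (yes _) p = ℕ.≤-refl
indicator-true (no ¬p) p = contradiction p ¬p

∑-indicator-≤1 : ∀ {k} {P : Fin k → Set} (P? : ∀ i → Dec (P i)) → (∀ {i j} → P i → P j → i ≡ j) →
  ∑ℕ.sum (λ i → indicator (P? i)) ≤ 1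
∑-indicator-≤1 {zero} P? unique = z≤n
∑-indicator-≤1 {suc k} {P} P? unique with P? zero
... | no _   = ∑-indicator-≤1 (P? ∘ suc) (λ p p′ → Fin.suc-injective (unique p p′))
... | yes p₀ = s≤s (ℕ.≤-reflexive (none (P? ∘ suc) (λ i p → Fin.0≢1+n (unique p₀ p))))
  where
  none : ∀ {k} {P : Fin k → Set} (P? : ∀ i → Dec (P i)) → (∀ i → ¬ P i) →
    ∑ℕ.sum (λ i → indicator (P? i)) ≡ 0
  none {zero} P? ¬P = refl
  none {suc k} P? ¬P with P? zero
  ... | yes p = contradiction p (¬P zero)
  ... | no _  = none (P? ∘ suc) (¬P ∘ suc)

-- Exchange of summation: each entry of the list contributes at most `B` over all `i`.
∑-tally-≤ : ∀ {k} {A : Set} (f : Fin k → A → ℕ) B → (∀ e → ∑ℕ.sum (λ i → f i e) ≤ B) →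
  ∀ es → ∑ℕ.sum (λ i → tally (f i) es) ≤ length es * B
∑-tally-≤ {k} f B f≤B [] = ℕ.≤-reflexive (∑ℕ.sum-replicate-zero k)
∑-tally-≤ f B f≤B (e ∷ es) =
  ℕ.≤-trans (ℕ.≤-reflexive (∑ℕ.∑-distrib-+ (λ i → f i e) (λ i → tally (f i) es)))
            (ℕ.+-mono-≤ (f≤B e) (∑-tally-≤ f B f≤B es))

∑-const : ∀ k a → ∑ℕ.sum {k} (λ _ → a) ≡ k * a
∑-const zero a = refl
∑-const (suc k) a = cong (a +_) (∑-const k a)

-- Shifted pairs against independent random strings

module Indistinguishable (m S D : ℕ) where
  open Construction m S D
  open Simulation

  coordinate : ∀ {s} → s ≤ S → Fin D → Fin (S + D)
  coordinate s≤S i = fromℕ< (ℕ.+-mono-≤-< s≤S (Fin.toℕ<n i))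

  toℕ-coordinate : ∀ {s} (s≤S : s ≤ S) i → toℕ (coordinate s≤S i) ≡ s + toℕ i
  toℕ-coordinate s≤S i = Fin.toℕ-fromℕ< _

  -- The letter of the common random string that a site shows in the pair with shifts 0 and `s`.
  locate : Fin S → Site → Fin (S + D)
  locate s (inj₁ i) = coordinate z≤n i
  locate s (inj₂ j) = coordinate (Fin.toℕ≤n s) j

  shifted-answers : ∀ r {s} (s≤S : s ≤ S) z o (site : Fin D → Site) →
    (∀ j → o (site j) ≡ lookup z (coordinate s≤S j)) →
    ∀ p → Answers r o (Sum.map₂ site (zone p)) (lookup (shifted r s (letter z)) p)
  shifted-answers r {s} s≤S z o site o-site p
    with zone p | lookup-assemble (sparse r (prefix s S (letter z)))
                    (tabulate (λ j → letter z (s + toℕ j)))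
                    (sparse r (suffix s S (letter z ∘ (D +_)))) p
  ... | inj₁ c | blank = λ c≢r → blank
    (λ p′ c≡ → lookup-sparse r _ p′ (λ eq → c≢r (trans (sym c≡) eq)))
    (λ p′ c≡ → lookup-sparse r _ p′ (λ eq → c≢r (trans (sym c≡) eq)))
  ... | inj₂ j | dense = trans dense (cong just (begin
    lookup (tabulate (λ j → letter z (s + toℕ j))) j ≡⟨ Vec.lookup∘tabulate _ j ⟩
    letter z (s + toℕ j)                             ≡⟨ letter-fromℕ< z (ℕ.+-mono-≤-< s≤S (Fin.toℕ<n j)) ⟩
    lookup z (coordinate s≤S j)                      ≡⟨ o-site j ⟨
    o (site j)                                       ∎))
    where open ≡-Reasoning

  unsynchronised-answers : ∀ r x o (site : Fin D → Site) →
    (∀ j → o (site j) ≡ lookup x j) →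
    ∀ p → Answers r o (Sum.map₂ site (zone p)) (lookup (unsynchronised x) p)
  unsynchronised-answers r x o site o-site p
    with zone p | lookup-assemble (replicate U nothing) x (replicate U nothing) p
  ... | inj₁ c | blank = λ _ → blank (λ p′ _ → Vec.lookup-replicate p′ nothing)
                                     (λ p′ _ → Vec.lookup-replicate p′ nothing)
  ... | inj₂ j | dense = trans dense (cong just (sym (o-site j)))

  leafwise : Fin m → Fin S → DecisionTree n → BitTree Site
  leafwise r s = simulate r (locate s) []

  -- In a shifted pair the middle letters are the bits of a uniform string read through `locate s`,
  -- so the fresh simulation rejects with probability `rejection`. Only an inequality results,
  -- because the simulation accepts as soon as the run reaches block `r`.
  rejection≤shifted : ∀ r s t → rejection (leafwise r s t) ℚ.≤
    𝔼 {S + D} (λ z → 𝟙 (not (run t (shifted r 0 (letter z)) (shifted r (toℕ s) (letter z)))))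
  rejection≤shifted r s t = ℚ.≤-trans
    (ℚ.≤-reflexive (sym (𝔼-eval (locate s) (simulate-fresh r (locate s) [] t))))
    (𝔼-mono {S + D} pointwise)
    where
    pointwise : ∀ z → 𝟙 (not (eval (leafwise r s t) (lookup z ∘ locate s))) ℚ.≤
      𝟙 (not (run t (shifted r 0 (letter z)) (shifted r (toℕ s) (letter z))))
    pointwise z
      with simulate-correct r (locate s) (lookup z ∘ locate s) (λ _ → ⊤) (λ _ _ → cong (lookup z))
             (shifted-answers r z≤n z _ inj₁ (λ _ → refl))
             (shifted-answers r (Fin.toℕ≤n s) z _ inj₂ (λ _ → refl))
             t {[]} [] (All.universal (λ _ → tt) _)
    ... | inj₁ (_ , accepts) rewrite accepts = 0≤𝟙 _
    ... | inj₂ eq = ℚ.≤-reflexive (cong (𝟙 ∘ not) eq)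

  -- Requiring `l ≢ l′` leaves out repeated reads of one site, which would collide for every shift
  -- and are harmless.
  Collision : Fin S → Event → Event → Set
  Collision s (inj₂ l) (inj₂ l′) = l ≢ l′ × locate s l ≡ locate s l′
  Collision s _        _         = ⊥

  _≟ˢ_ : (l l′ : Site) → Dec (l ≡ l′)
  _≟ˢ_ = Sum.≡-dec Fin._≟_ Fin._≟_

  collision? : ∀ s e e′ → Dec (Collision s e e′)
  collision? s (inj₁ _) (inj₁ _)  = no λ ()
  collision? s (inj₁ _) (inj₂ _)  = no λ ()
  collision? s (inj₂ _) (inj₁ _)  = no λ ()
  collision? s (inj₂ l) (inj₂ l′) = ¬? (l ≟ˢ l′) ×-dec (locate s l Fin.≟ locate s l′)

  hit? : ∀ (r : Fin m) (e : Event) → Dec (e ≡ inj₁ r)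
  hit? r e = Sum.≡-dec Fin._≟_ _≟ˢ_ e (inj₁ r)

  same-side : ∀ {s} (s≤S : s ≤ S) {i i′} → coordinate s≤S i ≡ coordinate s≤S i′ → i ≡ i′
  same-side {s} s≤S {i} {i′} eq = Fin.toℕ-injective (ℕ.+-cancelˡ-≡ s _ _
    (trans (sym (toℕ-coordinate s≤S i)) (trans (cong toℕ eq) (toℕ-coordinate s≤S i′))))

  shift-unique : ∀ {s s′ i j} → locate s (inj₁ i) ≡ locate s (inj₂ j) →
    locate s′ (inj₁ i) ≡ locate s′ (inj₂ j) → s ≡ s′
  shift-unique {s} {s′} {i} {j} eq eq′ = Fin.toℕ-injective (ℕ.+-cancelʳ-≡ (toℕ j) _ _
    (trans (sym (toℕ-coordinate (Fin.toℕ≤n s) j)) (trans (cong toℕ (trans (sym eq) eq′))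
           (toℕ-coordinate (Fin.toℕ≤n s′) j))))

  -- Within one string `locate s` is injective, so colliding sites lie in different strings, and
  -- then i = s + j determines `s`.
  collision-unique : ∀ e e′ {s s′} → Collision s e e′ → Collision s′ e e′ → s ≡ s′
  collision-unique (inj₂ (inj₁ i)) (inj₂ (inj₁ i′)) (l≢l′ , eq) _ =
    contradiction (cong inj₁ (same-side z≤n eq)) l≢l′
  collision-unique (inj₂ (inj₂ j)) (inj₂ (inj₂ j′)) {s} (l≢l′ , eq) _ =
    contradiction (cong inj₂ (same-side (Fin.toℕ≤n s) eq)) l≢l′
  collision-unique (inj₂ (inj₁ i)) (inj₂ (inj₂ j)) (_ , eq) (_ , eq′) = shift-unique eq eq′
  collision-unique (inj₂ (inj₂ j)) (inj₂ (inj₁ i)) (_ , eq) (_ , eq′) = shift-unique (sym eq) (sym eq′)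

  hits : Fin m → List Event → ℕ
  hits r = tally (λ e → indicator (hit? r e))

  collisions : Fin S → List Event → ℕ
  collisions s es = tally (λ e → tally (λ e′ → indicator (collision? s e e′)) es) es

  clashes : Fin m → Fin S → List Event → ℕ
  clashes r s es = hits r es + collisions s es

  hits-sum : ∀ es → ∑ℕ.sum (λ r → hits r es) ≤ length es
  hits-sum es = ℕ.≤-trans
    (∑-tally-≤ (λ r e → indicator (hit? r e)) 1
      (λ e → ∑-indicator-≤1 (λ r → hit? r e) (λ p p′ → Sum.inj₁-injective (trans (sym p) p′))) es)
    (ℕ.≤-reflexive (ℕ.*-identityʳ (length es)))

  collisions-sum : ∀ es → ∑ℕ.sum (λ s → collisions s es) ≤ length es * length es
  collisions-sum es =
    ∑-tally-≤ (λ s e → tally (λ e′ → indicator (collision? s e e′)) es) (length es)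
      (λ e → ℕ.≤-trans
        (∑-tally-≤ (λ s e′ → indicator (collision? s e e′)) 1
          (λ e′ → ∑-indicator-≤1 (λ s → collision? s e e′) (collision-unique e e′)) es)
        (ℕ.≤-reflexive (ℕ.*-identityʳ (length es)))) es

  -- Each query hits at most one block, and this is counted for each of the `S` shifts; each ordered
  -- pair of queries collides for at most one shift, and this is counted for each of the `m` blocks.
  clashes-sum : ∀ {q} es → length es ≤ q →
    ∑ℕ.sum (λ r → ∑ℕ.sum (λ s → clashes r s es)) ≤ S * q + m * (q * q)
  clashes-sum {q} es es≤q = begin
    ∑ℕ.sum (λ r → ∑ℕ.sum (λ s → hits r es + collisions s es))
      ≡⟨ ∑ℕ.sum-cong-≗ (λ r → trans (∑ℕ.∑-distrib-+ {S} (λ _ → hits r es) (λ s → collisions s es))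
                                     (cong (_+ c) (∑-const S (hits r es)))) ⟩
    ∑ℕ.sum (λ r → S * hits r es + c)
      ≡⟨ ∑ℕ.∑-distrib-+ (λ r → S * hits r es) (λ _ → c) ⟩
    ∑ℕ.sum (λ r → S * hits r es) + ∑ℕ.sum {m} (λ _ → c)
      ≡⟨ cong₂ _+_ (∑ℕ.*-distribˡ-sum S (λ r → hits r es)) (sym (∑-const m c)) ⟨
    S * ∑ℕ.sum (λ r → hits r es) + m * c
      ≤⟨ ℕ.+-mono-≤ (ℕ.*-monoʳ-≤ S (ℕ.≤-trans (hits-sum es) es≤q))
           (ℕ.*-monoʳ-≤ m (ℕ.≤-trans (collisions-sum es) (ℕ.*-mono-≤ es≤q es≤q))) ⟩
    S * q + m * (q * q) ∎
    where
    open ℕ.≤-Reasoning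
    c = ∑ℕ.sum (λ s → collisions s es)

  clash-free : ∀ r s es → clashes r s es ≡ 0 → (¬ (inj₁ r ∈ es)) ×
    (∀ {l l′} → inj₂ l ∈ es → inj₂ l′ ∈ es → locate s l ≡ locate s l′ → l ≡ l′)
  clash-free r s es none = no-hit , no-collision
    where
    no-hit : ¬ (inj₁ r ∈ es)
    no-hit r∈es = ℕ.1+n≰n (ℕ.≤-trans
      (ℕ.≤-trans (indicator-true (hit? r (inj₁ r)) refl) (∈⇒≤tally (λ e → indicator (hit? r e)) r∈es))
      (ℕ.≤-reflexive (ℕ.m+n≡0⇒m≡0 (hits r es) none)))
    no-collision : ∀ {l l′} → inj₂ l ∈ es → inj₂ l′ ∈ es → locate s l ≡ locate s l′ → l ≡ l′
    no-collision {l} {l′} l∈es l′∈es eq with l ≟ˢ l′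
    ... | yes l≡l′ = l≡l′
    ... | no l≢l′ = contradiction (ℕ.≤-trans
      (ℕ.≤-trans (indicator-true (collision? s (inj₂ l) (inj₂ l′)) (l≢l′ , eq))
        (ℕ.≤-trans (∈⇒≤tally (λ e′ → indicator (collision? s (inj₂ l) e′)) l′∈es)
          (∈⇒≤tally (λ e → tally (λ e′ → indicator (collision? s e e′)) es) l∈es)))
      (ℕ.≤-reflexive (ℕ.m+n≡0⇒n≡0 (hits r es) none))) ℕ.1+n≰n

  rejects : DecisionTree n → Vec Bool D → Vec Bool D → ℚ
  rejects t x y = 𝟙 (not (run t (unsynchronised x) (unsynchronised y)))

  trace : DecisionTree n → Vec Bool D → Vec Bool D → List Event
  trace t x y = events t (unsynchronised x) (unsynchronised y)

  -- Two independent strings form one random string of length D + D on which distinct sites have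
  -- distinct coordinates. By `fresh-map` the simulation is fresh there as well and rejects with the
  -- same probability `rejection`. It can deviate from the run only at a clash.
  unsynchronised≤rejection : ∀ r s t → 𝔼² (rejects t) ℚ.≤
    rejection (leafwise r s t) ℚ.+ 𝔼² (λ x y → fromℕ (clashes r s (trace t x y)))
  unsynchronised≤rejection r s t = begin
    𝔼² (rejects t)
      ≤⟨ 𝔼²-mono pointwise ⟩
    𝔼² (λ x y → simulated x y ℚ.+ fromℕ (clashes r s (trace t x y)))
      ≡⟨ 𝔼²-+ simulated (λ x y → fromℕ (clashes r s (trace t x y))) ⟩
    𝔼² simulated ℚ.+ 𝔼² (λ x y → fromℕ (clashes r s (trace t x y)))
      ≡⟨ cong (ℚ._+ 𝔼² (λ x y → fromℕ (clashes r s (trace t x y)))) simulated≡rejection ⟩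
    rejection (leafwise r s t) ℚ.+ 𝔼² (λ x y → fromℕ (clashes r s (trace t x y))) ∎
    where
    open ℚ.≤-Reasoning
    oracle : Vec Bool D → Vec Bool D → Site → Bool
    oracle x y = [ lookup x , lookup y ]′
    simulated : Vec Bool D → Vec Bool D → ℚ
    simulated x y = 𝟙 (not (eval (leafwise r s t) (oracle x y)))
    joined : ∀ x y l → lookup (x Vec.++ y) (Fin.join D D l) ≡ oracle x y l
    joined x y (inj₁ i) = Vec.lookup-++ˡ x y i
    joined x y (inj₂ j) = Vec.lookup-++ʳ x y j
    join-injective : ∀ {l l′} → Fin.join D D l ≡ Fin.join D D l′ → l ≡ l′
    join-injective {l} {l′} eq =
      trans (sym (Fin.splitAt-join D D l)) (trans (cong (splitAt D) eq) (Fin.splitAt-join D D l′))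
    simulated≡rejection : 𝔼² simulated ≡ rejection (leafwise r s t)
    simulated≡rejection = trans
      (𝔼²-cong (λ x y → cong (𝟙 ∘ not) (sym (eval-cong (leafwise r s t) (joined x y)))))
      (trans (sym (𝔼-++ D (λ z → 𝟙 (not (eval (leafwise r s t) (lookup z ∘ Fin.join D D))))))
             (𝔼-eval (Fin.join D D) (fresh-map (λ {l} {l′} eq → cong (locate s) (join-injective {l} {l′} eq))
               (simulate-fresh r (locate s) [] t))))
    pointwise : ∀ x y → rejects t x y ℚ.≤ simulated x y ℚ.+ fromℕ (clashes r s (trace t x y))
    pointwise x y with clashes r s (trace t x y) in eq
    -- A single clash already pays for the largest possible difference, 1.
    ... | suc k = begin
      rejects t x y                  ≤⟨ 𝟙≤1 (not (run t (unsynchronised x) (unsynchronised y))) ⟩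
      0ℚ ℚ.+ fromℕ 1                 ≤⟨ ℚ.+-mono-≤ (0≤𝟙 (not (eval (leafwise r s t) (oracle x y))))
                                          (fromℕ-mono-≤ {1} {suc k} (s≤s z≤n)) ⟩
      simulated x y ℚ.+ fromℕ (suc k) ∎
    ... | zero with clash-free r s (trace t x y) eq
    ...   | no-hit , no-collision
      with simulate-correct r (locate s) (oracle x y) (_∈ trace t x y)
             (λ l∈ l′∈ eq → cong (oracle x y) (no-collision l∈ l′∈ eq))
             (unsynchronised-answers r x (oracle x y) inj₁ (λ _ → refl))
             (unsynchronised-answers r y (oracle x y) inj₂ (λ _ → refl))
             t {[]} [] (All.tabulate (λ e∈ → e∈))
    ...     | inj₁ (hit , _) = contradiction hit no-hit
    ...     | inj₂ correct = ℚ.≤-reflexive (trans (cong (𝟙 ∘ not) (sym correct)) (sym (ℚ.+-identityʳ _)))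

-- Averaging over the hard instances

fromℕ≥0 : ∀ k → 0ℚ ℚ.≤ fromℕ k
fromℕ≥0 k = fromℕ-mono-≤ {0} {k} z≤n

sum² : ∀ {j k} → (Fin j → Fin k → ℚ) → ℚ
sum² f = sum (λ r → sum (f r))

sum²-mono : ∀ {j k} {f g : Fin j → Fin k → ℚ} → (∀ r s → f r s ℚ.≤ g r s) → sum² f ℚ.≤ sum² g
sum²-mono f≤g = sum-mono (λ r → sum-mono (f≤g r))

sum²-+ : ∀ {j k} (f g : Fin j → Fin k → ℚ) → sum² (λ r s → f r s ℚ.+ g r s) ≡ sum² f ℚ.+ sum² g
sum²-+ f g = trans (∑ℚ.sum-cong-≗ (λ r → ∑ℚ.∑-distrib-+ (f r) (g r)))
                   (∑ℚ.∑-distrib-+ (λ r → sum (f r)) (λ r → sum (g r)))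

sum²-const : ∀ j k a → sum² {j} {k} (λ _ _ → a) ≡ fromℕ (j * k) ℚ.* a
sum²-const j k a = begin
  sum {j} (λ _ → sum {k} (λ _ → a))  ≡⟨ sum-const j (sum {k} (λ _ → a)) ⟩
  fromℕ j ℚ.* sum {k} (λ _ → a)      ≡⟨ cong (fromℕ j ℚ.*_) (sum-const k a) ⟩
  fromℕ j ℚ.* (fromℕ k ℚ.* a)        ≡⟨ ℚ.*-assoc (fromℕ j) (fromℕ k) a ⟨
  fromℕ j ℚ.* fromℕ k ℚ.* a          ≡⟨ cong (ℚ._* a) (fromℕ-* j k) ⟨
  fromℕ (j * k) ℚ.* a                ∎
  where open ≡-Reasoning

sum²-* : ∀ {j k} a (f : Fin j → Fin k → ℚ) → sum² (λ r s → a ℚ.* f r s) ≡ a ℚ.* sum² f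
sum²-* a f = sym (trans (∑ℚ.*-distribˡ-sum a (λ r → sum (f r)))
                        (∑ℚ.sum-cong-≗ (λ r → ∑ℚ.*-distribˡ-sum a (f r))))

sum-sum² : ∀ {i j k} (f : Fin i → Fin j → Fin k → ℚ) →
  sum (λ τ → sum² (f τ)) ≡ sum² (λ r s → sum (λ τ → f τ r s))
sum-sum² f = trans (∑ℚ.∑-comm (λ τ r → sum (f τ r))) (∑ℚ.sum-cong-≗ (λ r → ∑ℚ.∑-comm (λ τ → f τ r)))

module Averaging (m S D : ℕ) where
  open Construction m S D
  open Indistinguishable m S D

  shifted-rejects : Fin m → Fin S → DecisionTree n → Vec Bool (S + D) → ℚ
  shifted-rejects r s t z = 𝟙 (not (run t (shifted r 0 (letter z)) (shifted r (toℕ s) (letter z))))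

  -- This is m S (q / m + q² / S): errors are summed over all choices of block and shift rather than
  -- averaged, which avoids division.
  loss : ℕ → ℕ
  loss q = S * q + m * (q * q)

  -- The trace belongs to the unsynchronised pair and so depends on neither `r` nor `s`. After
  -- exchanging sum and average, `clashes-sum` applies to each fixed trace.
  average-clashes : ∀ q t → (∀ w v → queries t w v ≤ q) →
    sum² (λ r s → 𝔼² (λ x y → fromℕ (clashes r s (trace t x y)))) ℚ.≤ fromℕ (loss q)
  average-clashes q t t≤q = begin
    sum² (λ r s → 𝔼² (c r s))
      ≡⟨ ∑ℚ.sum-cong-≗ (λ r → 𝔼²-sum (c r)) ⟨
    sum (λ r → 𝔼² (λ x y → sum (λ s → c r s x y)))
      ≡⟨ 𝔼²-sum (λ r x y → sum (λ s → c r s x y)) ⟨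
    𝔼² (λ x y → sum² (λ r s → c r s x y))
      ≤⟨ 𝔼²-mono total ⟩
    𝔼² {D} {D} (λ _ _ → fromℕ (loss q))
      ≡⟨ 𝔼²-const {D} {D} (fromℕ (loss q)) ⟩
    fromℕ (loss q) ∎
    where
    open ℚ.≤-Reasoning
    c : Fin m → Fin S → Vec Bool D → Vec Bool D → ℚ
    c r s x y = fromℕ (clashes r s (trace t x y))
    total : ∀ x y → sum² (λ r s → c r s x y) ℚ.≤ fromℕ (loss q)
    total x y = begin
      sum² (λ r s → c r s x y)
        ≡⟨ ∑ℚ.sum-cong-≗ (λ r → fromℕ-sum (λ s → clashes r s (trace t x y))) ⟨
      sum (λ r → fromℕ (∑ℕ.sum (λ s → clashes r s (trace t x y))))
        ≡⟨ fromℕ-sum (λ r → ∑ℕ.sum (λ s → clashes r s (trace t x y))) ⟨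
      fromℕ (∑ℕ.sum (λ r → ∑ℕ.sum (λ s → clashes r s (trace t x y))))
        ≤⟨ fromℕ-mono-≤ (clashes-sum (trace t x y)
             (ℕ.≤-trans (ℕ.≤-reflexive (length-events t _ _)) (t≤q _ _))) ⟩
      fromℕ (loss q) ∎

  -- For every `r` and `s` both kinds of instance are compared with the same number
  -- `rejection (leafwise r s t)`.
  tree-bound : ∀ q t → (∀ w v → queries t w v ≤ q) →
    fromℕ U ℚ.* 𝔼² (rejects t) ℚ.≤ sum² (λ r s → 𝔼 (shifted-rejects r s t)) ℚ.+ fromℕ (loss q)
  tree-bound q t t≤q = begin
    fromℕ U ℚ.* 𝔼² (rejects t)
      ≡⟨ sum²-const m S (𝔼² (rejects t)) ⟨
    sum² {m} {S} (λ _ _ → 𝔼² (rejects t))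
      ≤⟨ sum²-mono (λ r s → ℚ.≤-trans (unsynchronised≤rejection r s t)
           (ℚ.+-monoˡ-≤ (c r s) (rejection≤shifted r s t))) ⟩
    sum² (λ r s → 𝔼 (shifted-rejects r s t) ℚ.+ c r s)
      ≡⟨ sum²-+ (λ r s → 𝔼 (shifted-rejects r s t)) c ⟩
    sum² (λ r s → 𝔼 (shifted-rejects r s t)) ℚ.+ sum² c
      ≤⟨ ℚ.+-monoʳ-≤ (sum² (λ r s → 𝔼 (shifted-rejects r s t))) (average-clashes q t t≤q) ⟩
    sum² (λ r s → 𝔼 (shifted-rejects r s t)) ℚ.+ fromℕ (loss q) ∎
    where
    open ℚ.≤-Reasoning
    c : Fin m → Fin S → ℚ
    c r s = 𝔼² (λ x y → fromℕ (clashes r s (trace t x y)))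

  module _ {k} (a : Fin k → ℚ) (a≥0 : ∀ τ → 0ℚ ℚ.≤ a τ) (tr : Fin k → DecisionTree n) where

    mix : (DecisionTree n → ℚ) → ℚ
    mix f = sum (λ τ → a τ ℚ.* f (tr τ))

    -- Linearity in the tree. The weights are only approximate probabilities, so their sum stays as
    -- a factor of the loss.
    mixture-bound : ∀ q → (∀ τ w v → queries (tr τ) w v ≤ q) →
      fromℕ U ℚ.* 𝔼² (λ x y → mix (λ t → rejects t x y)) ℚ.≤
      sum² (λ r s → 𝔼 (λ z → mix (λ t → shifted-rejects r s t z))) ℚ.+ sum a ℚ.* fromℕ (loss q)
    mixture-bound q tr≤q = begin
      fromℕ U ℚ.* 𝔼² (λ x y → mix (λ t → rejects t x y))
        ≡⟨ cong (fromℕ U ℚ.*_) (trans (𝔼²-sum (λ τ x y → a τ ℚ.* rejects (tr τ) x y))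
             (∑ℚ.sum-cong-≗ (λ τ → 𝔼²-* (a τ) (rejects (tr τ))))) ⟩
      fromℕ U ℚ.* sum (λ τ → a τ ℚ.* 𝔼² (rejects (tr τ)))
        ≡⟨ ∑ℚ.*-distribˡ-sum (fromℕ U) (λ τ → a τ ℚ.* 𝔼² (rejects (tr τ))) ⟩
      sum (λ τ → fromℕ U ℚ.* (a τ ℚ.* 𝔼² (rejects (tr τ))))
        ≡⟨ ∑ℚ.sum-cong-≗ (λ τ → swap (fromℕ U) (a τ) (𝔼² (rejects (tr τ)))) ⟩
      sum (λ τ → a τ ℚ.* (fromℕ U ℚ.* 𝔼² (rejects (tr τ))))
        ≤⟨ sum-mono (λ τ → ℚ.*-monoˡ-≤-nonNeg (a τ) {{ℚ.nonNegative (a≥0 τ)}}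
             (tree-bound q (tr τ) (tr≤q τ))) ⟩
      sum (λ τ → a τ ℚ.* (sum² (λ r s → 𝔼 (shifted-rejects r s (tr τ))) ℚ.+ fromℕ (loss q)))
        ≡⟨ ∑ℚ.sum-cong-≗ (λ τ → trans
             (ℚ.*-distribˡ-+ (a τ) (sum² (λ r s → 𝔼 (shifted-rejects r s (tr τ)))) (fromℕ (loss q)))
             (cong (ℚ._+ a τ ℚ.* fromℕ (loss q))
               (sym (sum²-* (a τ) (λ r s → 𝔼 (shifted-rejects r s (tr τ))))))) ⟩
      sum (λ τ → sum² (λ r s → a τ ℚ.* 𝔼 (shifted-rejects r s (tr τ))) ℚ.+ a τ ℚ.* fromℕ (loss q))
        ≡⟨ ∑ℚ.∑-distrib-+ (λ τ → sum² (λ r s → a τ ℚ.* 𝔼 (shifted-rejects r s (tr τ))))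
             (λ τ → a τ ℚ.* fromℕ (loss q)) ⟩
      sum (λ τ → sum² (λ r s → a τ ℚ.* 𝔼 (shifted-rejects r s (tr τ)))) ℚ.+ sum (λ τ → a τ ℚ.* fromℕ (loss q))
        ≡⟨ cong₂ ℚ._+_
             (trans (sum-sum² (λ τ r s → a τ ℚ.* 𝔼 (shifted-rejects r s (tr τ))))
               (∑ℚ.sum-cong-≗ (λ r → ∑ℚ.sum-cong-≗ (λ s →
                 sym (trans (𝔼-sum (λ τ z → a τ ℚ.* shifted-rejects r s (tr τ) z))
                            (∑ℚ.sum-cong-≗ (λ τ → 𝔼-* (a τ) (shifted-rejects r s (tr τ)))))))))
             (sym (∑ℚ.*-distribʳ-sum (fromℕ (loss q)) a)) ⟩
      sum² (λ r s → 𝔼 (λ z → mix (λ t → shifted-rejects r s t z))) ℚ.+ sum a ℚ.* fromℕ (loss q) ∎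
      where
      open ℚ.≤-Reasoning
      swap : ∀ a b c → a ℚ.* (b ℚ.* c) ≡ b ℚ.* (a ℚ.* c)
      swap = solve 3 (λ a b c → a :* (b :* c) := b :* (a :* c)) refl
        where open +-*-Solver

    mix≥0 : ∀ x y → 0ℚ ℚ.≤ mix (λ t → rejects t x y)
    mix≥0 x y = subst (ℚ._≤ mix (λ t → rejects t x y)) (∑ℚ.sum-replicate-zero k)
      (sum-mono {k} {λ _ → 0ℚ} (λ τ → subst (ℚ._≤ a τ ℚ.* rejects (tr τ) x y) (ℚ.*-zeroʳ (a τ))
        (ℚ.*-monoˡ-≤-nonNeg (a τ) {{ℚ.nonNegative (a≥0 τ)}} (0≤𝟙 _))))

    -- The terms on the right are the rejection of shifted pairs, the clash error at total weight at
    -- most `W`, and the chance of at most 1/8 that two random strings are close.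
    separation : ∀ q e α β W → (∀ τ w v → queries (tr τ) w v ≤ q) → 8 * loss q ≤ U → 0 < U →
      bound D e ℚ.≤ ⅛ → 0ℚ ℚ.≤ β → sum a ℚ.≤ W →
      (∀ r s z → mix (λ t → shifted-rejects r s t z) ℚ.≤ α) →
      (∀ x y → edits? (toList y) (toList x) e ≡ false → β ℚ.≤ mix (λ t → rejects t x y)) →
      β ℚ.≤ α ℚ.+ W ℚ.* ⅛ ℚ.+ β ℚ.* ⅛
    separation q e α β W tr≤q loss≤ U>0 D-large β≥0 a≤W yes≤α no≥β = begin
      β
        ≤⟨ far-often ⟩
      ρ ℚ.+ β ℚ.* ⅛
        ≤⟨ ℚ.+-monoˡ-≤ (β ℚ.* ⅛) ρ≤ ⟩
      α ℚ.+ W ℚ.* ⅛ ℚ.+ β ℚ.* ⅛ ∎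
      where
      open ℚ.≤-Reasoning
      ρ : ℚ
      ρ = 𝔼² (λ x y → mix (λ t → rejects t x y))
      near : Vec Bool D → Vec Bool D → ℚ
      near x y = β ℚ.* within (toList x) e y
      W≥0 : 0ℚ ℚ.≤ W
      W≥0 = ℚ.≤-trans (subst (ℚ._≤ sum a) (∑ℚ.sum-replicate-zero k) (sum-mono {k} {λ _ → 0ℚ} a≥0)) a≤W
      pointwise : ∀ x y → β ℚ.≤ mix (λ t → rejects t x y) ℚ.+ near x y
      pointwise x y with edits? (toList y) (toList x) e in eq
      ... | true = begin
        β                                            ≡⟨ ℚ.+-identityˡ β ⟨
        0ℚ ℚ.+ β                                     ≡⟨ cong (0ℚ ℚ.+_) (ℚ.*-identityʳ β) ⟨
        0ℚ ℚ.+ β ℚ.* 1ℚ                              ≤⟨ ℚ.+-monoˡ-≤ (β ℚ.* 1ℚ) (mix≥0 x y) ⟩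
        mix (λ t → rejects t x y) ℚ.+ β ℚ.* 1ℚ       ∎
      ... | false = begin
        β                                            ≤⟨ no≥β x y eq ⟩
        mix (λ t → rejects t x y)                    ≡⟨ ℚ.+-identityʳ _ ⟨
        mix (λ t → rejects t x y) ℚ.+ 0ℚ             ≡⟨ cong (mix (λ t → rejects t x y) ℚ.+_) (ℚ.*-zeroʳ β) ⟨
        mix (λ t → rejects t x y) ℚ.+ β ℚ.* 0ℚ       ∎
      near≤ : 𝔼² near ℚ.≤ β ℚ.* ⅛
      near≤ = begin
        𝔼² near
          ≡⟨ 𝔼²-* {D} {D} β (λ x y → within (toList x) e y) ⟩
        β ℚ.* 𝔼² {D} {D} (λ x y → within (toList x) e y)
          ≤⟨ ℚ.*-monoˡ-≤-nonNeg β {{ℚ.nonNegative β≥0}} (begin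
               𝔼² {D} {D} (λ x y → within (toList x) e y)
                 ≤⟨ 𝔼-mono {D} (λ x → ℚ.≤-trans (𝔼-edits D (toList x) e)
                      (ℚ.≤-trans (ℚ.≤-reflexive (cong (λ ℓ → bound ℓ e) (Vec.length-toList x))) D-large)) ⟩
               𝔼 {D} (λ _ → ⅛)
                 ≡⟨ 𝔼-const {D} ⅛ ⟩
               ⅛ ∎) ⟩
        β ℚ.* ⅛ ∎
      far-often : β ℚ.≤ ρ ℚ.+ β ℚ.* ⅛
      far-often = begin
        β
          ≡⟨ 𝔼²-const {D} {D} β ⟨
        𝔼² {D} {D} (λ _ _ → β)
          ≤⟨ 𝔼²-mono pointwise ⟩
        𝔼² (λ x y → mix (λ t → rejects t x y) ℚ.+ near x y)
          ≡⟨ 𝔼²-+ (λ x y → mix (λ t → rejects t x y)) near ⟩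
        ρ ℚ.+ 𝔼² near
          ≤⟨ ℚ.+-monoʳ-≤ ρ near≤ ⟩
        ρ ℚ.+ β ℚ.* ⅛ ∎
      loss≤⅛U : fromℕ (loss q) ℚ.≤ ⅛ ℚ.* fromℕ U
      loss≤⅛U = begin
        fromℕ (loss q)                     ≡⟨ ℚ.*-identityˡ (fromℕ (loss q)) ⟨
        (⅛ ℚ.* fromℕ 8) ℚ.* fromℕ (loss q) ≡⟨ ℚ.*-assoc ⅛ (fromℕ 8) (fromℕ (loss q)) ⟩
        ⅛ ℚ.* (fromℕ 8 ℚ.* fromℕ (loss q)) ≡⟨ cong (⅛ ℚ.*_) (fromℕ-* 8 (loss q)) ⟨
        ⅛ ℚ.* fromℕ (8 * loss q)           ≤⟨ ℚ.*-monoˡ-≤-nonNeg ⅛ (fromℕ-mono-≤ loss≤) ⟩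
        ⅛ ℚ.* fromℕ U                      ∎
      Uρ≤ : fromℕ U ℚ.* ρ ℚ.≤ fromℕ U ℚ.* (α ℚ.+ W ℚ.* ⅛)
      Uρ≤ = begin
        fromℕ U ℚ.* ρ
          ≤⟨ mixture-bound q tr≤q ⟩
        sum² (λ r s → 𝔼 (λ z → mix (λ t → shifted-rejects r s t z))) ℚ.+ sum a ℚ.* fromℕ (loss q)
          ≤⟨ ℚ.+-mono-≤
               (sum²-mono {m} {S} (λ r s → ℚ.≤-trans (𝔼-mono (yes≤α r s)) (ℚ.≤-reflexive (𝔼-const {S + D} α))))
               (ℚ.≤-trans (scale (sum a) W (fromℕ (loss q)) (fromℕ≥0 (loss q)) a≤W)
                          (ℚ.*-monoˡ-≤-nonNeg W {{ℚ.nonNegative W≥0}} loss≤⅛U)) ⟩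
        sum² {m} {S} (λ _ _ → α) ℚ.+ W ℚ.* (⅛ ℚ.* fromℕ U)
          ≡⟨ cong (ℚ._+ W ℚ.* (⅛ ℚ.* fromℕ U)) (sum²-const m S α) ⟩
        fromℕ U ℚ.* α ℚ.+ W ℚ.* (⅛ ℚ.* fromℕ U)
          ≡⟨ regroup (fromℕ U) α W ⟩
        fromℕ U ℚ.* (α ℚ.+ W ℚ.* ⅛) ∎
        where
        regroup : ∀ u α W → u ℚ.* α ℚ.+ W ℚ.* (⅛ ℚ.* u) ≡ u ℚ.* (α ℚ.+ W ℚ.* ⅛)
        regroup = solve 3 (λ u α W → u :* α :+ W :* (con ⅛ :* u) := u :* (α :+ W :* con ⅛)) refl
          where open +-*-Solver
      ρ≤ : ρ ℚ.≤ α ℚ.+ W ℚ.* ⅛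
      ρ≤ = ℚ.*-cancelˡ-≤-pos (fromℕ U) {{ℚ.positive (fromℕ-mono-< {0} {U} U>0)}} Uρ≤

-- Rational approximations of a tester

Eventually : (ℕ → Set) → Set
Eventually P = ∃[ M ] (∀ i → M ≤ i → P i)

eventually-× : ∀ {P Q} → Eventually P → Eventually Q → Eventually (λ i → P i × Q i)
eventually-× (M , p) (M′ , q) = M ⊔ M′ , λ i M≤i →
  p i (ℕ.m⊔n≤o⇒m≤o M M′ M≤i) , q i (ℕ.m⊔n≤o⇒n≤o M M′ M≤i)

-- Trees, blocks, shifts and bit strings are finite in number, so one index of the Cauchy sequences
-- can serve all requirements on a tester at once.
eventually-Fin : ∀ {k} {P : Fin k → ℕ → Set} → (∀ a → Eventually (P a)) → Eventually (λ i → ∀ a → P a i)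
eventually-Fin {zero} p = 0 , λ i _ ()
eventually-Fin {suc k} p with eventually-× (p zero) (eventually-Fin (p ∘ suc))
... | M , q = M , λ i M≤i → λ { zero → proj₁ (q i M≤i) ; (suc a) → proj₂ (q i M≤i) a }

eventually-Vec : ∀ {k} {P : Vec Bool k → ℕ → Set} → (∀ z → Eventually (P z)) →
  Eventually (λ i → ∀ z → P z i)
eventually-Vec {zero} p with p []
... | M , q = M , λ i M≤i → λ { [] → q i M≤i }
eventually-Vec {suc k} p
  with eventually-× (eventually-Vec (p ∘ (false ∷_))) (eventually-Vec (p ∘ (true ∷_)))
... | M , q = M , λ i M≤i → λ { (false ∷ z) → proj₁ (q i M≤i) z ; (true ∷ z) → proj₂ (q i M≤i) z }

eventually-if : ∀ {b} {P : ℕ → Set} → (b ≡ false → Eventually P) → Eventually (λ i → b ≡ false → P i)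
eventually-if {true}  p = 0 , λ _ _ ()
eventually-if {false} p = proj₁ (p refl) , λ i M≤i _ → proj₂ (p refl) i M≤i

seq-∑ : ∀ {k} (f : Fin k → ℝ) i → seq (∑ f) i ≡ sum (λ τ → seq (f τ) i)
seq-∑ {zero} f i = refl
seq-∑ {suc k} f i = cong (seq (f zero) i ℚ.+_) (seq-∑ (f ∘ suc) i)

⅔ℚ η : ℚ
⅔ℚ = ℤ.+ 2 ℚ./ 3
η = ℤ.+ 1 ℚ./ 100

-- `β` bounds from below the mass of a correct answer when an error `η` is allowed. The total mass
-- is at most 1 + η, so `α` bounds the mass of rejecting an equivalent pair.
α β : ℚ
β = ⅔ℚ ℚ.- η
α = 1ℚ ℚ.+ η ℚ.- β

-- The two sides are about 0.657 and 0.562. The comparison evaluates to `false`, so the type of its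
-- Boolean form is empty.
gap : ¬ (β ℚ.≤ α ℚ.+ (1ℚ ℚ.+ η) ℚ.* ⅛ ℚ.+ β ℚ.* ⅛)
gap = ℚ.≤⇒≤ᵇ

β≥0 : 0ℚ ℚ.≤ β
β≥0 = ℚ.≤ᵇ⇒≤ {0ℚ} {β} _

+-cancel : ∀ p q → p ℚ.+ q ℚ.- q ≡ p
+-cancel p q = trans (ℚ.+-assoc p q (ℚ.- q)) (trans (cong (p ℚ.+_) (ℚ.+-inverseʳ q)) (ℚ.+-identityʳ p))

-- The tolerance δ is so small that adding it to each approximate weight, which makes them all
-- nonnegative, changes their sum by less than η.
tolerance : ∀ k → ∃[ δ ] (0ℚ ℚ.< δ × δ ℚ.≤ η × δ ℚ.+ fromℕ k ℚ.* δ ≡ η)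
tolerance k = δ , 0<δ , δ≤η , δ+kδ≡η
  where
  instance
    k+1-pos : ℚ.Positive (fromℕ (suc k))
    k+1-pos = ℚ.positive (fromℕ-mono-< {0} {suc k} (s≤s z≤n))
    k+1≢0 : ℚ.NonZero (fromℕ (suc k))
    k+1≢0 = ℚ.pos⇒nonZero (fromℕ (suc k))
  δ : ℚ
  δ = η ℚ.* ℚ.1/ fromℕ (suc k)
  0<δ : 0ℚ ℚ.< δ
  0<δ = ℚ.positive⁻¹ δ {{ℚ.pos*pos⇒pos η (ℚ.1/ fromℕ (suc k)) {{ℚ.1/pos⇒pos (fromℕ (suc k))}}}}
  δ+kδ≡η : δ ℚ.+ fromℕ k ℚ.* δ ≡ η
  δ+kδ≡η = begin
    δ ℚ.+ fromℕ k ℚ.* δ                  ≡⟨ cong (ℚ._+ fromℕ k ℚ.* δ) (ℚ.*-identityˡ δ) ⟨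
    1ℚ ℚ.* δ ℚ.+ fromℕ k ℚ.* δ           ≡⟨ ℚ.*-distribʳ-+ δ 1ℚ (fromℕ k) ⟨
    (1ℚ ℚ.+ fromℕ k) ℚ.* δ               ≡⟨ cong (ℚ._* δ) (fromℕ-+ 1 k) ⟨
    fromℕ (suc k) ℚ.* δ                  ≡⟨ swap (fromℕ (suc k)) η (ℚ.1/ fromℕ (suc k)) ⟩
    η ℚ.* (fromℕ (suc k) ℚ.* ℚ.1/ fromℕ (suc k)) ≡⟨ cong (η ℚ.*_) (ℚ.*-inverseʳ (fromℕ (suc k))) ⟩
    η ℚ.* 1ℚ                             ≡⟨ ℚ.*-identityʳ η ⟩
    η                                    ∎
    where
    open ≡-Reasoning
    swap : ∀ a b c → a ℚ.* (b ℚ.* c) ≡ b ℚ.* (a ℚ.* c)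
    swap = solve 3 (λ a b c → a :* (b :* c) := b :* (a :* c)) refl
      where open +-*-Solver
  δ≤η : δ ℚ.≤ η
  δ≤η = begin
    δ                     ≡⟨ ℚ.+-identityʳ δ ⟨
    δ ℚ.+ 0ℚ              ≡⟨ cong (δ ℚ.+_) (ℚ.*-zeroˡ δ) ⟨
    δ ℚ.+ 0ℚ ℚ.* δ        ≤⟨ ℚ.+-monoʳ-≤ δ (scale 0ℚ (fromℕ k) δ (ℚ.<⇒≤ 0<δ) (fromℕ≥0 k)) ⟩
    δ ℚ.+ fromℕ k ℚ.* δ   ≡⟨ δ+kδ≡η ⟩
    η                     ∎
    where open ℚ.≤-Reasoning

module Sampling {n} (A : RandomizedAlgorithm n) (δ : ℚ) (0<δ : 0ℚ ℚ.< δ) where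

  b : ℕ → Fin (support A) → ℚ
  b i τ = seq (weight A τ) i

  mass : (Fin (support A) → Bool) → ℕ → ℚ
  mass E i = sum (λ τ → (b i τ ℚ.+ δ) ℚ.* 𝟙 (E τ))

  seq-probability≤mass : ∀ E i → (∀ τ → 0ℚ ℚ.≤ b i τ ℚ.+ δ) →
    seq (probability A E) i ℚ.≤ mass E i
  seq-probability≤mass E i b≥ = ℚ.≤-trans
    (ℚ.≤-reflexive (seq-∑ (λ τ → if E τ then weight A τ else fromℚ 0ℚ) i))
    (sum-mono pointwise)
    where
    pointwise : ∀ τ → seq (if E τ then weight A τ else fromℚ 0ℚ) i ℚ.≤ (b i τ ℚ.+ δ) ℚ.* 𝟙 (E τ)
    pointwise τ with E τ
    ... | false = ℚ.≤-reflexive (sym (ℚ.*-zeroʳ (b i τ ℚ.+ δ)))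
    ... | true  = begin
      b i τ                       ≡⟨ ℚ.+-identityʳ (b i τ) ⟨
      b i τ ℚ.+ 0ℚ                ≤⟨ ℚ.+-monoʳ-≤ (b i τ) (ℚ.<⇒≤ 0<δ) ⟩
      b i τ ℚ.+ δ                 ≡⟨ ℚ.*-identityʳ (b i τ ℚ.+ δ) ⟨
      (b i τ ℚ.+ δ) ℚ.* 1ℚ        ∎
      where open ℚ.≤-Reasoning

  nonnegative : Eventually (λ i → ∀ τ → 0ℚ ℚ.≤ b i τ ℚ.+ δ)
  nonnegative = eventually-Fin (λ τ → weight≥0 A τ δ 0<δ)

  total : Eventually (λ i → sum (λ τ → b i τ ℚ.+ δ) ℚ.≤ 1ℚ ℚ.+ (δ ℚ.+ fromℕ (support A) ℚ.* δ))
  total with proj₁ (∑-weight≈1 A) δ 0<δ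
  ... | M , ≤1+δ = M , λ i M≤i → begin
    sum (λ τ → b i τ ℚ.+ δ)
      ≡⟨ ∑ℚ.∑-distrib-+ (b i) (λ _ → δ) ⟩
    sum (b i) ℚ.+ sum {support A} (λ _ → δ)
      ≡⟨ cong₂ ℚ._+_ (sym (seq-∑ (weight A) i)) (sum-const (support A) δ) ⟩
    seq (∑ (weight A)) i ℚ.+ fromℕ (support A) ℚ.* δ
      ≤⟨ ℚ.+-monoˡ-≤ (fromℕ (support A) ℚ.* δ) (≤1+δ i M≤i) ⟩
    1ℚ ℚ.+ δ ℚ.+ fromℕ (support A) ℚ.* δ
      ≡⟨ ℚ.+-assoc 1ℚ δ (fromℕ (support A) ℚ.* δ) ⟩
    1ℚ ℚ.+ (δ ℚ.+ fromℕ (support A) ℚ.* δ) ∎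
    where open ℚ.≤-Reasoning

  likely : ∀ E → ⅔ ≤ᵣ probability A E →
    Eventually (λ i → (∀ τ → 0ℚ ℚ.≤ b i τ ℚ.+ δ) → ⅔ℚ ℚ.≤ mass E i ℚ.+ δ)
  likely E ⅔≤Pr with ⅔≤Pr δ 0<δ
  ... | M , ⅔≤ = M , λ i M≤i b≥ →
    ℚ.≤-trans (⅔≤ i M≤i) (ℚ.+-monoˡ-≤ δ (seq-probability≤mass E i b≥))

-- Refuting a tester with few queries

ε : ℚ
ε = ℤ.+ 1 ℚ./ 64

module _ (m S D e : ℕ) where
  open Construction m S D
  open Averaging m S D

  Distant : Set
  Distant = ∀ x y → edits? (toList y) (toList x) e ≡ false → Far ε (unsynchronised x) (unsynchronised y)

  -- At one late index of the Cauchy sequences the weights, raised by a small tolerance, are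
  -- nonnegative rationals that meet all requirements approximately. Then `separation` applies to
  -- them and contradicts `gap`.
  no-tester : ∀ q → 8 * loss q ≤ U → 0 < U → bound D e ℚ.≤ ⅛ → Distant →
    (A : RandomizedAlgorithm n) → IsTester ε A → ¬ MakesAtMost q A
  no-tester q loss≤ U>0 D-large distant A (accepts , rejects) A≤q =
    let δ , 0<δ , δ≤η , δ+kδ≡η = tolerance (support A) in refute δ 0<δ δ≤η δ+kδ≡η
    where
    module _ (δ : ℚ) (0<δ : 0ℚ ℚ.< δ) (δ≤η : δ ℚ.≤ η) (δ+kδ≡η : δ ℚ.+ fromℕ (support A) ℚ.* δ ≡ η) where
      open Sampling A δ 0<δ

      runs-shifted : Fin m → Fin S → Vec Bool (S + D) → Fin (support A) → Bool
      runs-shifted r s z τ = run (tree A τ) (shifted r 0 (letter z)) (shifted r (toℕ s) (letter z))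
      runs-unsynchronised : Vec Bool D → Vec Bool D → Fin (support A) → Bool
      runs-unsynchronised x y τ = run (tree A τ) (unsynchronised x) (unsynchronised y)

      NonNegative : ℕ → Set
      NonNegative i = ∀ τ → 0ℚ ℚ.≤ b i τ ℚ.+ δ
      Total Accepts Rejects Sampled : ℕ → Set
      Accepts i = ∀ r s z → NonNegative i → ⅔ℚ ℚ.≤ mass (runs-shifted r s z) i ℚ.+ δ
      Rejects i = ∀ x y → edits? (toList y) (toList x) e ≡ false → NonNegative i →
        ⅔ℚ ℚ.≤ mass (not ∘ runs-unsynchronised x y) i ℚ.+ δ
      Total i = sum (λ τ → b i τ ℚ.+ δ) ℚ.≤ 1ℚ ℚ.+ (δ ℚ.+ fromℕ (support A) ℚ.* δ)
      Sampled i = (NonNegative i × Total i) ×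
                  (Accepts i × Rejects i)

      equivalent : ∀ r s z → TruestringEquivalent (shifted r 0 (letter z)) (shifted r (toℕ s) (letter z))
      equivalent r s z = trans (truestring-shifted r (letter z) z≤n)
                               (sym (truestring-shifted r (letter z) (Fin.toℕ≤n s)))

      eventually-accepts : Eventually Accepts
      eventually-accepts = eventually-Fin λ r → eventually-Fin λ s → eventually-Vec λ z →
        likely (runs-shifted r s z) (accepts _ _ (equivalent r s z))

      eventually-rejects : Eventually Rejects
      eventually-rejects = eventually-Vec λ x → eventually-Vec λ y → eventually-if λ far →
        likely (not ∘ runs-unsynchronised x y) (rejects _ _ (distant x y far))

      samples : Eventually Sampled
      samples = eventually-× {λ i → NonNegative i × Total i} {λ i → Accepts i × Rejects i}
        (eventually-× {NonNegative} {Total} nonnegative total)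
        (eventually-× {Accepts} {Rejects} eventually-accepts eventually-rejects)

      conclude : ∀ i → Sampled i → ⊥
      conclude i ((a≥0 , a≤) , yes≥ , no≥) = gap
        (separation a a≥0 (tree A) q e α β (1ℚ ℚ.+ η) A≤q loss≤ U>0 D-large β≥0 a≤1+η yes≤α no≥β)
        where
        a : Fin (support A) → ℚ
        a τ = b i τ ℚ.+ δ
        a≤1+η : sum a ℚ.≤ 1ℚ ℚ.+ η
        a≤1+η = subst (λ x → sum a ℚ.≤ 1ℚ ℚ.+ x) δ+kδ≡η a≤
        β≤ : ∀ p → ⅔ℚ ℚ.≤ p ℚ.+ δ → β ℚ.≤ p
        β≤ p ⅔≤p+δ = subst (β ℚ.≤_) (+-cancel p η)
          (ℚ.+-monoˡ-≤ (ℚ.- η) (ℚ.≤-trans ⅔≤p+δ (ℚ.+-monoʳ-≤ p δ≤η)))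
        mass-complement : ∀ E → mass (not ∘ E) i ℚ.+ mass E i ≡ sum a
        mass-complement E = trans
          (sym (∑ℚ.∑-distrib-+ (λ τ → a τ ℚ.* 𝟙 (not (E τ))) (λ τ → a τ ℚ.* 𝟙 (E τ))))
          (∑ℚ.sum-cong-≗ (λ τ → trans (sym (ℚ.*-distribˡ-+ (a τ) (𝟙 (not (E τ))) (𝟙 (E τ))))
            (trans (cong (a τ ℚ.*_) (𝟙-not (E τ))) (ℚ.*-identityʳ (a τ)))))
          where
          𝟙-not : ∀ b → 𝟙 (not b) ℚ.+ 𝟙 b ≡ 1ℚ
          𝟙-not true  = refl
          𝟙-not false = refl
        -- Rejection has the total mass minus the mass of acceptance, hence at most 1 + η - β.
        yes≤α : ∀ r s z → mass (not ∘ runs-shifted r s z) i ℚ.≤ α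
        yes≤α r s z = begin
          mass (not ∘ E) i                             ≡⟨ +-cancel (mass (not ∘ E) i) (mass E i) ⟨
          mass (not ∘ E) i ℚ.+ mass E i ℚ.- mass E i   ≡⟨ cong (ℚ._- mass E i) (mass-complement E) ⟩
          sum a ℚ.- mass E i
            ≤⟨ ℚ.+-mono-≤ a≤1+η (ℚ.neg-antimono-≤ (β≤ (mass E i) (yes≥ r s z a≥0))) ⟩
          α                                            ∎
          where
          open ℚ.≤-Reasoning
          E = runs-shifted r s z
        no≥β : ∀ x y → edits? (toList y) (toList x) e ≡ false → β ℚ.≤ mass (not ∘ runs-unsynchronised x y) i
        no≥β x y far = β≤ _ (no≥ x y far a≥0)

      refute : ⊥
      refute = conclude (proj₁ samples) (proj₂ samples (proj₁ samples) ℕ.≤-refl)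

-- An equivalent pair at distance d with 64 d ≤ n would turn one truestring into the other by 2 d ≤
-- e edits.
far-from-edits : ∀ {n} (w v : Vec Symbol n) e → (∀ d → 64 * d ≤ n → 2 * d ≤ e) →
  edits? (truestring v) (truestring w) e ≡ false → Far ε w v
far-from-edits {n} w v e small no-edits w′ v′ equiv with 64 * pairDistance w v w′ v′ ℕ.≤? n
... | yes 64d≤n = contradiction
  (trans (sym no-edits) (edits?-complete (weaken (small (pairDistance w v w′ v′) 64d≤n)
                                           (equivalent⇒edits w v w′ v′ equiv)))) λ ()
... | no 64d≰n = begin-strict
  ε ℚ.* fromℕ n                         <⟨ ℚ.*-monoʳ-<-pos ε (fromℕ-mono-< (ℕ.≰⇒> 64d≰n)) ⟩
  ε ℚ.* fromℕ (64 * d)                  ≡⟨ cong (ε ℚ.*_) (fromℕ-* 64 d) ⟩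
  ε ℚ.* (fromℕ 64 ℚ.* fromℕ d)          ≡⟨ ℚ.*-assoc ε (fromℕ 64) (fromℕ d) ⟨
  1ℚ ℚ.* fromℕ d                        ≡⟨ ℚ.*-identityˡ (fromℕ d) ⟩
  fromℕ d                               ∎
  where
  open ℚ.≤-Reasoning
  d = pairDistance w v w′ v′

-- Choice of parameters

module Parameters (q : ℕ) where

  -- The factors 16 make q / m and q² / S at most 1/16 each, 1/8 together; `suc q` keeps both
  -- parameters positive when no query is made.
  m S : ℕ
  m = 16 * suc q
  S = 16 * (suc q * suc q)

  loss-small : ∀ D → 8 * Averaging.loss m S D q ≤ m * S
  loss-small D = begin
    8 * (S * q + m * (q * q))
      ≤⟨ ℕ.*-monoʳ-≤ 8 (ℕ.+-mono-≤ (ℕ.*-monoʳ-≤ S (ℕ.n≤1+n q))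
           (ℕ.*-monoʳ-≤ m (ℕ.*-mono-≤ (ℕ.n≤1+n q) (ℕ.n≤1+n q)))) ⟩
    8 * (S * suc q + m * (suc q * suc q))
      ≡⟨ solve 1 (λ p → con 8 :* (con 16 :* (p :* p) :* p :+ con 16 :* p :* (p :* p))
                      := con 16 :* p :* (con 16 :* (p :* p))) refl (suc q) ⟩
    m * S ∎
    where
    open ℕ.≤-Reasoning
    open ℕ-Solver

  -- 4 m S is 1024 (q + 1)³. For q = 0 this is the assumed lower bound on `n`; otherwise q + 1 ≤ 2 q
  -- gives at most 8192 q³, which is below 32768 q⁵ = (8 q)⁵.
  fits : ∀ {n} → 1024 ≤ n → (8 * q) ^ 5 < n → 4 * (m * S) ≤ n
  fits {n} 1024≤n q<n = ℕ.≤-trans (ℕ.≤-reflexive cube) (cubic q q<n)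
    where
    cube : 4 * (m * S) ≡ 1024 * (suc q * (suc q * suc q))
    cube = solve 1 (λ p → con 4 :* (con 16 :* p :* (con 16 :* (p :* p)))
                        := con 1024 :* (p :* (p :* p))) refl (suc q)
      where open ℕ-Solver
    cubic : ∀ q → (8 * q) ^ 5 < n → 1024 * (suc q * (suc q * suc q)) ≤ n
    cubic zero _ = 1024≤n
    cubic p@(suc p-1) p<n = begin
      1024 * (suc p * (suc p * suc p))
        ≤⟨ ℕ.*-monoʳ-≤ 1024 (ℕ.*-mono-≤ 1+p≤2p (ℕ.*-mono-≤ 1+p≤2p 1+p≤2p)) ⟩
      1024 * ((2 * p) * ((2 * p) * (2 * p)))
        ≡⟨ solve 1 (λ p → con 1024 :* ((con 2 :* p) :* ((con 2 :* p) :* (con 2 :* p)))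
                        := con 8192 :* (p :* p :* p)) refl p ⟩
      8192 * (p * p * p)
        ≤⟨ ℕ.*-mono-≤ (ℕ.m≤m*n 8192 4) (ℕ.m≤m*n (p * p * p) (p * p)) ⟩
      32768 * (p * p * p * (p * p))
        ≡⟨ solve 1 (λ p → con 32768 :* (p :* p :* p :* (p :* p)) := (con 8 :* p) :^ 5) refl p ⟩
      (8 * p) ^ 5
        ≤⟨ ℕ.<⇒≤ p<n ⟩
      n ∎
      where
      open ℕ.≤-Reasoning
      open ℕ-Solver
      1+p≤2p : suc p ≤ 2 * p
      1+p≤2p = ℕ.≤-trans (ℕ.+-monoˡ-≤ p (s≤s {0} {p-1} z≤n))
                        (ℕ.≤-reflexive (cong (p +_) (sym (ℕ.+-identityʳ p))))

-- There are at least 16 letters per allowed edit. Absorbing an edit takes 7, and since 16 ≤ D rules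
-- out zero edits, at least 9 letters are left over, enough for `¾^8≤⅛`.
bound-sixteenth : ∀ D → 16 ≤ D → bound D (D / 16) ℚ.≤ ⅛
bound-sixteenth D 16≤D with D / 16 | ℕ.m≡m%n+[m/n]*n D 16 | ℕ./-monoˡ-≤ 16 16≤D
... | suc e | D≡ | _ = subst (λ ℓ → bound ℓ (suc e) ℚ.≤ ⅛) (sym (trans D≡ (regroup (D % 16) e)))
  (bound-small (suc e) (1 + 9 * e + D % 16))
  where
  regroup : ∀ r e → r + suc e * 16 ≡ suc e * 7 + (8 + (1 + 9 * e + r))
  regroup = solve 2 (λ r e → r :+ (con 1 :+ e) :* con 16
                          := (con 1 :+ e) :* con 7 :+ (con 8 :+ (con 1 :+ con 9 :* e :+ r))) refl
    where open ℕ-Solver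

lower-bound : ∀ q D n → 1024 ≤ n → 4 * (Parameters.m q * Parameters.S q) ≤ n →
  n ≡ Construction.n (Parameters.m q) (Parameters.S q) D →
  (A : RandomizedAlgorithm n) → IsTester ε A → ¬ MakesAtMost q A
lower-bound q D n 1024≤n 4U≤n refl =
  no-tester m S D (D / 16) q (loss-small D) (s≤s z≤n) (bound-sixteenth D 16≤D) distant
  where
  open Parameters q
  open Construction m S D using (U; unsynchronised; truestring-unsynchronised)
  open ℕ.≤-Reasoning
  -- The two sides have length 2 U, at most half of `n`, so the middle fills at least the other
  -- half.
  n≤2D : n ≤ 2 * D
  n≤2D = ℕ.+-cancelˡ-≤ n n (2 * D) (begin
    n + n                       ≡⟨ solve 2 (λ u d → (u :+ (d :+ u)) :+ (u :+ (d :+ u))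
                                                  := con 4 :* u :+ con 2 :* d) refl U D ⟩
    4 * U + 2 * D               ≤⟨ ℕ.+-monoˡ-≤ (2 * D) 4U≤n ⟩
    n + 2 * D                   ∎)
    where open ℕ-Solver
  16≤D : 16 ≤ D
  16≤D = ℕ.*-cancelˡ-≤ 2 (ℕ.≤-trans (ℕ.≤-trans (ℕ.m≤m*n 32 32) 1024≤n) n≤2D)
  -- This fixes ε = 1/64: 2 d ≤ n / 32 ≤ D / 16, the number of edits that random strings of length
  -- `D` withstand.
  small : ∀ d → 64 * d ≤ n → 2 * d ≤ D / 16
  small d 64d≤n = begin
    2 * d                       ≡⟨ ℕ.m*n/n≡m (2 * d) 16 ⟨
    (2 * d) * 16 / 16           ≤⟨ ℕ./-monoˡ-≤ 16 (ℕ.*-cancelˡ-≤ {2 * d * 16} {D} 2 (begin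
      2 * (2 * d * 16)            ≡⟨ solve 1 (λ d → con 2 :* (con 2 :* d :* con 16) := con 64 :* d) refl d ⟩
      64 * d                      ≤⟨ 64d≤n ⟩
      n                           ≤⟨ n≤2D ⟩
      2 * D                       ∎)) ⟩
    D / 16                      ∎
    where open ℕ-Solver
  distant : Distant m S D (D / 16)
  distant x y no-edits = far-from-edits (unsynchronised x) (unsynchronised y) (D / 16) small
    (trans (cong₂ (λ t u → edits? t u (D / 16)) (truestring-unsynchronised y)
                  (truestring-unsynchronised x)) no-edits)

theorem5p1 : Σ[ ε ∈ ℚ ] (0ℚ <ℚ ε ×
    (Σ[ k ∈ ℕ ] (0 < k ×
    (Σ[ n₀ ∈ ℕ ]
    (∀ (n : ℕ) → n₀ ≤ n →
    ∀ (A : RandomizedAlgorithm n) → IsTester ε A →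
    ∀ (q : ℕ) → MakesAtMost q A →
    n ≤ (k * q) ^ 5)))))
-- The factor 8 and the threshold 1024 are those of `fits`.
theorem5p1 = ε , ℚ.positive⁻¹ ε , 8 , s≤s z≤n , 1024 , bounded
  where
  bounded : ∀ n → 1024 ≤ n → ∀ (A : RandomizedAlgorithm n) → IsTester ε A →
    ∀ q → MakesAtMost q A → n ≤ (8 * q) ^ 5
  bounded n 1024≤n A tester q A≤q with n ℕ.≤? (8 * q) ^ 5
  ... | yes n≤ = n≤
  ... | no n≰ = contradiction A≤q (lower-bound q D n 1024≤n 4U≤n n≡ A tester)
    where
    open Parameters q
    U = m * S
    4U≤n : 4 * U ≤ n
    4U≤n = fits 1024≤n (ℕ.≰⇒> n≰)
    -- The middle takes whatever the two sides leave, so every sufficiently large length is reached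
    -- exactly.
    rest : ∃[ D ] (U + U + D ≡ n)
    rest = ℕ.m≤n⇒∃[o]m+o≡n (ℕ.≤-trans (ℕ.+-monoʳ-≤ U (ℕ.m≤m+n U (2 * U))) 4U≤n)
    D = proj₁ rest
    n≡ : n ≡ U + (D + U)
    n≡ = trans (sym (proj₂ rest)) (trans (ℕ.+-assoc U U D) (cong (U +_) (ℕ.+-comm U D)))
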